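{- Let $(M_k)_{k=1}^\infty$ be a sequence of ordered matchings, where $M_k$ has size $k$, $k=1,2,\dots$. Then, asymptotically almost surely, $$\max\{k:\; M_k\preceq \mathbb{RM}_n\}\le (1+o(1))\,e\sqrt{n/2},$$ i.e., there is a sequence $\varepsilon_n\to0$ such that the probability that $\max\{k:\; M_k\preceq \mathbb{RM}_n\}\le (1+\varepsilon_n)e\sqrt{n/2}$ tends to $1$ as $n\to\infty$.
   Context: An ordered matching of size $k$ is a graph on a linearly ordered vertex set of $2k$ vertices consisting of $k$ pairwise vertex-disjoint edges. $\mathbb{RM}_n$ denotes a random ordered matching of size $n$, selected uniformly at random from all $(2n)!/(n!2^n)$ matchings of size $n$ on the vertex set $\{1,\dots,2n\}$ with its natural order. Two ordered graphs on $m$ vertices $v_1<\cdots<v_m$ and $w_1<\cdots<w_m$ are order-isomorphic if for all $i<j$, $v_iv_j$ is an edge of the first if and only if $w_iw_j$ is an edge of the second. For ordered matchings $H$ and $G$, $H\preceq G$ means that $G$ contains an ordered copy of $H$, i.e., a sub-matching (with vertices ordered as in $G$) order-isomorphic to $H$. "Asymptotically almost surely" (a.a.s.) means with probability tending to $1$ as $n\to\infty$. -}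

module Defs where

open import Data.Bool.Base using (Bool; true; false; T)
open import Data.Bool.Properties using (T?)
open import Data.Empty using (⊥-elim)
open import Data.Fin.Base as Fin using (Fin)
import Data.Fin.Properties as Fin
open import Data.Integer.Base as ℤ using (+_)
import Data.Integer.Properties as ℤ
open import Data.List.Base
  using (List; []; _∷_; map; length; filter; mapMaybe; cartesianProduct; cartesianProductWith; allFin)
open import Data.List.Membership.Propositional using (_∈_)
import Data.List.Membership.Propositional.Properties as ∈
open import Data.List.Relation.Unary.All using ([]; _∷_)
open import Data.List.Relation.Unary.AllPairs using (AllPairs; []; _∷_; allPairs?)
open import Data.List.Relation.Unary.Any using (here; there)
open import Data.List.Relation.Unary.Unique.Propositional using (Unique)
import Data.List.Relation.Unary.Unique.Propositional.Properties as Unique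
open import Data.Maybe.Base using (Maybe)
import Data.Maybe.Base as Maybe
open import Data.Nat.Base as ℕ
  using (ℕ; zero; suc; NonZero; _!; z≤n; s≤s)
import Data.Nat.DivMod as ℕ
import Data.Nat.Properties as ℕ
open import Data.Nat.Properties using (_!≢0)
open import Data.Nat.Tactic.RingSolver using (solve-∀)
open import Data.Product.Base using (Σ; Σ-syntax; ∃; _×_; _,_; proj₁; proj₂)
open import Data.Rational.Base as ℚ using (ℚ; mkℚ; 0ℚ; 1ℚ; ½; ∣_∣; ↥_; ↧ₙ_)
import Data.Rational.Properties as ℚ
import Data.Rational.Solver as ℚ
open import Data.Rational.Unnormalised.Base as ℚᵘ using (mkℚᵘ)
import Data.Rational.Unnormalised.Properties as ℚᵘ
open import Data.Sum.Base using (inj₁; inj₂)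
open import Data.Vec.Base as Vec using (Vec; []; _∷_; lookup; tabulate)
import Data.Vec.Properties as Vec
open import Function.Base using (_∘_; _$_)
open import Function.Bundles using (_⇔_)
open import Relation.Binary.PropositionalEquality
  using (_≡_; _≢_; refl; sym; trans; cong; cong₂; subst; subst₂)
open import Relation.Nullary.Decidable using (Dec; yes; no; _×-dec_; _→-dec_; ¬?; dec⇒maybe)
open import Relation.Nullary.Negation using (¬_)

frac-≤ : ∀ a b c d .{{_ : NonZero b}} .{{_ : NonZero d}} →
         a ℕ.* d ℕ.≤ c ℕ.* b → (+ a) ℚ./ b ℚ.≤ (+ c) ℚ./ d
frac-≤ a b@(suc b-1) c d@(suc d-1) ad≤cb = ℚ.toℚᵘ-cancel-≤ $ begin
  ℚ.toℚᵘ ((+ a) ℚ./ b)  ≃⟨ ℚ.toℚᵘ-fromℚᵘ (mkℚᵘ (+ a) b-1) ⟩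
  mkℚᵘ (+ a) b-1        ≤⟨ ℚᵘ.*≤* (subst₂ ℤ._≤_ (ℤ.pos-* a d) (ℤ.pos-* c b) (ℤ.+≤+ ad≤cb)) ⟩
  mkℚᵘ (+ c) d-1        ≃⟨ ℚ.toℚᵘ-fromℚᵘ (mkℚᵘ (+ c) d-1) ⟨
  ℚ.toℚᵘ ((+ c) ℚ./ d)  ∎
  where open ℚᵘ.≤-Reasoning

frac-≡ : ∀ a b c d .{{_ : NonZero b}} .{{_ : NonZero d}} →
         a ℕ.* d ≡ c ℕ.* b → (+ a) ℚ./ b ≡ (+ c) ℚ./ d
frac-≡ a b c d eq = ℚ.≤-antisym
  (frac-≤ a b c d (ℕ.≤-reflexive eq)) (frac-≤ c d a b (ℕ.≤-reflexive (sym eq)))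

frac-+ : ∀ a c b .{{_ : NonZero b}} →
         (+ a) ℚ./ b ℚ.+ (+ c) ℚ./ b ≡ (+ (a ℕ.+ c)) ℚ./ b
frac-+ a c b@(suc b-1) = ℚ.toℚᵘ-injective $ begin-equality
  ℚ.toℚᵘ ((+ a) ℚ./ b ℚ.+ (+ c) ℚ./ b)
    ≃⟨ ℚ.toℚᵘ-homo-+ ((+ a) ℚ./ b) ((+ c) ℚ./ b) ⟩
  ℚ.toℚᵘ ((+ a) ℚ./ b) ℚᵘ.+ ℚ.toℚᵘ ((+ c) ℚ./ b)
    ≃⟨ ℚᵘ.+-cong (ℚ.toℚᵘ-fromℚᵘ (mkℚᵘ (+ a) b-1)) (ℚ.toℚᵘ-fromℚᵘ (mkℚᵘ (+ c) b-1)) ⟩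
  mkℚᵘ (+ a) b-1 ℚᵘ.+ mkℚᵘ (+ c) b-1
    ≃⟨ ℚᵘ.*≡* eq ⟩
  mkℚᵘ (+ (a ℕ.+ c)) b-1
    ≃⟨ ℚ.toℚᵘ-fromℚᵘ (mkℚᵘ (+ (a ℕ.+ c)) b-1) ⟨
  ℚ.toℚᵘ ((+ (a ℕ.+ c)) ℚ./ b) ∎
  where
  open ℚᵘ.≤-Reasoning
  eq : (+ a ℤ.* + b ℤ.+ + c ℤ.* + b) ℤ.* + b ≡ + (a ℕ.+ c) ℤ.* (+ b ℤ.* + b)
  eq = trans (cong (ℤ._* + b) (sym (ℤ.*-distribʳ-+ (+ b) (+ a) (+ c))))
             (ℤ.*-assoc (+ (a ℕ.+ c)) (+ b) (+ b))

frac-* : ∀ a b .{{_ : NonZero b}} .{{_ : NonZero (b ℕ.* b)}} →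
         (+ a) ℚ./ b ℚ.* ((+ a) ℚ./ b) ≡ (+ (a ℕ.* a)) ℚ./ (b ℕ.* b)
frac-* a b@(suc b-1) = ℚ.toℚᵘ-injective $ begin-equality
  ℚ.toℚᵘ ((+ a) ℚ./ b ℚ.* ((+ a) ℚ./ b))
    ≃⟨ ℚ.toℚᵘ-homo-* ((+ a) ℚ./ b) ((+ a) ℚ./ b) ⟩
  ℚ.toℚᵘ ((+ a) ℚ./ b) ℚᵘ.* ℚ.toℚᵘ ((+ a) ℚ./ b)
    ≃⟨ ℚᵘ.*-cong (ℚ.toℚᵘ-fromℚᵘ (mkℚᵘ (+ a) b-1)) (ℚ.toℚᵘ-fromℚᵘ (mkℚᵘ (+ a) b-1)) ⟩
  mkℚᵘ (+ a) b-1 ℚᵘ.* mkℚᵘ (+ a) b-1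
    ≃⟨ ℚᵘ.*≡* (cong (ℤ._* + (b ℕ.* b)) (sym (ℤ.pos-* a a))) ⟩
  mkℚᵘ (+ (a ℕ.* a)) (ℕ.pred (b ℕ.* b))
    ≃⟨ ℚ.toℚᵘ-fromℚᵘ (mkℚᵘ (+ (a ℕ.* a)) (ℕ.pred (b ℕ.* b))) ⟨
  ℚ.toℚᵘ ((+ (a ℕ.* a)) ℚ./ (b ℕ.* b)) ∎
  where open ℚᵘ.≤-Reasoning

archimedean : ∀ δ → 0ℚ ℚ.< δ → ∃ λ N → (+ 1) ℚ./ suc N ℚ.≤ δ
archimedean δ@(mkℚ (+ suc a) d-1 _) _ = d-1 , subst (_ ℚ.≤_) (ℚ.↥p/↧p≡p δ)
  (frac-≤ 1 (suc d-1) (suc a) (suc d-1) (ℕ.*-monoˡ-≤ (suc d-1) (s≤s (z≤n {a}))))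
archimedean (mkℚ (+ zero) d-1 _) (ℚ.*<* (ℤ.+<+ ()))
archimedean (mkℚ ℤ.-[1+ n ] d-1 _) (ℚ.*<* ())

+-cancel-≤ : ∀ {p q r} → p ℚ.≤ q ℚ.+ r → p ℚ.- q ℚ.≤ r
+-cancel-≤ {p} {q} {r} le = subst (p ℚ.- q ℚ.≤_)
  (solve 2 (λ q r → q :+ r :- q := r) refl q r) (ℚ.+-monoˡ-≤ (ℚ.- q) le)
  where open ℚ.+-*-Solver

∣-∣-≤ : ∀ {p q r} → p ℚ.≤ q ℚ.+ r → q ℚ.≤ p ℚ.+ r → ∣ p ℚ.- q ∣ ℚ.≤ r
∣-∣-≤ {p} {q} {r} p≤ q≤ with ℚ.∣p∣≡p∨∣p∣≡-p (p ℚ.- q)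
... | inj₁ eq = subst (ℚ._≤ r) (sym eq) (+-cancel-≤ {p} {q} p≤)
... | inj₂ eq = subst (ℚ._≤ r)
      (sym (trans eq (solve 2 (λ p q → :- (p :- q) := q :- p) refl p q)))
      (+-cancel-≤ {q} {p} q≤)
  where open ℚ.+-*-Solver

∣-∣-sym : ∀ p q → ∣ p ℚ.- q ∣ ≡ ∣ q ℚ.- p ∣
∣-∣-sym p q = trans (sym (ℚ.∣-p∣≡∣p∣ (p ℚ.- q)))
  (cong ∣_∣ (solve 2 (λ p q → :- (p :- q) := q :- p) refl p q))
  where open ℚ.+-*-Solver

half>0 : ∀ {δ} → 0ℚ ℚ.< δ → 0ℚ ℚ.< ½ ℚ.* δ
half>0 {δ} 0<δ = subst (ℚ._< ½ ℚ.* δ) (ℚ.*-zeroʳ ½) (ℚ.*-monoʳ-<-pos ½ 0<δ)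

half+half : ∀ δ → ½ ℚ.* δ ℚ.+ ½ ℚ.* δ ≡ δ
half+half δ = trans (sym (ℚ.*-distribʳ-+ δ ½ ½)) (ℚ.*-identityˡ δ)

IsCauchy : (ℕ → ℚ) → Set
IsCauchy x = ∀ δ → 0ℚ ℚ.< δ →
  ∃ λ N → ∀ m n → N ℕ.≤ m → N ℕ.≤ n → ∣ x m ℚ.- x n ∣ ℚ.≤ δ

-- Reals are Cauchy sequences of rationals, not quotiented: _≃ℝ_ is the equality.
record ℝ : Set where
  constructor mkℝ
  field
    approx   : ℕ → ℚ
    isCauchy : IsCauchy approx

open ℝ public

infix 4 _≤ℝ_ _≃ℝ_

_≤ℝ_ : ℝ → ℝ → Set
x ≤ℝ y = ∀ δ → 0ℚ ℚ.< δ →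
  ∃ λ N → ∀ n → N ℕ.≤ n → approx x n ℚ.≤ approx y n ℚ.+ δ

_≃ℝ_ : ℝ → ℝ → Set
x ≃ℝ y = x ≤ℝ y × y ≤ℝ x

fromℚ : ℚ → ℝ
fromℚ q = mkℝ (λ _ → q) λ δ 0<δ → 0 , λ _ _ _ _ →
  subst (ℚ._≤ δ) (sym (cong ∣_∣ (ℚ.+-inverseʳ q))) (ℚ.<⇒≤ 0<δ)

fromℕ : ℕ → ℝ
fromℕ n = fromℚ ((+ n) ℚ./ 1)

+-cauchy : ∀ {x y} → IsCauchy x → IsCauchy y → IsCauchy (λ n → x n ℚ.+ y n)
+-cauchy {x} {y} cx cy δ 0<δ
  with N₁ , h₁ ← cx _ (half>0 0<δ) | N₂ , h₂ ← cy _ (half>0 0<δ)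
  = N₁ ℕ.⊔ N₂ , λ m n N≤m N≤n → begin
    ∣ (x m ℚ.+ y m) ℚ.- (x n ℚ.+ y n) ∣
      ≡⟨ cong ∣_∣ (solve 4 (λ a b c d → (a :+ b) :- (c :+ d) := (a :- c) :+ (b :- d))
           refl (x m) (y m) (x n) (y n)) ⟩
    ∣ (x m ℚ.- x n) ℚ.+ (y m ℚ.- y n) ∣
      ≤⟨ ℚ.∣p+q∣≤∣p∣+∣q∣ (x m ℚ.- x n) (y m ℚ.- y n) ⟩
    ∣ x m ℚ.- x n ∣ ℚ.+ ∣ y m ℚ.- y n ∣
      ≤⟨ ℚ.+-mono-≤
           (h₁ m n (ℕ.m⊔n≤o⇒m≤o N₁ N₂ N≤m) (ℕ.m⊔n≤o⇒m≤o N₁ N₂ N≤n))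
           (h₂ m n (ℕ.m⊔n≤o⇒n≤o N₁ N₂ N≤m) (ℕ.m⊔n≤o⇒n≤o N₁ N₂ N≤n)) ⟩
    ½ ℚ.* δ ℚ.+ ½ ℚ.* δ
      ≡⟨ half+half δ ⟩
    δ ∎
  where
  open ℚ.≤-Reasoning
  open ℚ.+-*-Solver

bounded : ∀ {x} → IsCauchy x →
          ∃ λ N → ∃ λ B → 0ℚ ℚ.< B × (∀ n → N ℕ.≤ n → ∣ x n ∣ ℚ.≤ B)
bounded {x} cx with N , h ← cx 1ℚ (ℚ.positive⁻¹ 1ℚ) =
  N , 1ℚ ℚ.+ ∣ x N ∣ , ℚ.+-mono-<-≤ (ℚ.positive⁻¹ 1ℚ) (ℚ.0≤∣p∣ (x N)) , λ n N≤n → begin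
    ∣ x n ∣                       ≡⟨ cong ∣_∣ (solve 2 (λ a b → a := (a :- b) :+ b) refl (x n) (x N)) ⟩
    ∣ (x n ℚ.- x N) ℚ.+ x N ∣     ≤⟨ ℚ.∣p+q∣≤∣p∣+∣q∣ (x n ℚ.- x N) (x N) ⟩
    ∣ x n ℚ.- x N ∣ ℚ.+ ∣ x N ∣   ≤⟨ ℚ.+-monoˡ-≤ ∣ x N ∣ (h n N N≤n ℕ.≤-refl) ⟩
    1ℚ ℚ.+ ∣ x N ∣ ∎
  where
  open ℚ.≤-Reasoning
  open ℚ.+-*-Solver

quotient : ∀ B → 0ℚ ℚ.< B → ∀ δ → 0ℚ ℚ.< δ → ∃ λ δ′ → 0ℚ ℚ.< δ′ × B ℚ.* δ′ ≡ δ
quotient B 0<B δ 0<δ = δ ℚ.* 1/B , ℚ.positive⁻¹ _ {{ℚ.pos*pos⇒pos δ 1/B}} , eq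
  where
  instance
    B⁺ = ℚ.positive 0<B
    δ⁺ = ℚ.positive 0<δ
    B≢0 = ℚ.pos⇒nonZero B
    1/B⁺ = ℚ.1/pos⇒pos B
  1/B = ℚ.1/ B
  open ℚ.+-*-Solver
  eq : B ℚ.* (δ ℚ.* 1/B) ≡ δ
  eq = trans (solve 3 (λ b d i → b :* (d :* i) := d :* (b :* i)) refl B δ 1/B)
       (trans (cong (δ ℚ.*_) (ℚ.*-inverseʳ B)) (ℚ.*-identityʳ δ))

*-mono-∣∣ : ∀ p q {B δ} → ∣ p ∣ ℚ.≤ B → ∣ q ∣ ℚ.≤ δ → ∣ p ℚ.* q ∣ ℚ.≤ B ℚ.* δ
*-mono-∣∣ p q {B} {δ} p≤B q≤δ = begin
  ∣ p ℚ.* q ∣      ≡⟨ ℚ.∣p*q∣≡∣p∣*∣q∣ p q ⟩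
  ∣ p ∣ ℚ.* ∣ q ∣  ≤⟨ ℚ.*-monoʳ-≤-nonNeg ∣ q ∣ {{ℚ.∣-∣-nonNeg q}} p≤B ⟩
  B ℚ.* ∣ q ∣      ≤⟨ ℚ.*-monoˡ-≤-nonNeg B {{ℚ.nonNegative (ℚ.≤-trans (ℚ.0≤∣p∣ p) p≤B)}} q≤δ ⟩
  B ℚ.* δ          ∎
  where open ℚ.≤-Reasoning

*-split : ∀ a b c d → a ℚ.* b ℚ.- c ℚ.* d ≡ a ℚ.* (b ℚ.- d) ℚ.+ d ℚ.* (a ℚ.- c)
*-split = solve 4 (λ a b c d →
  (a :* b) :- (c :* d) := a :* (b :- d) :+ d :* (a :- c)) refl
  where open ℚ.+-*-Solver

*-close : ∀ {x y x′ y′ B C δ₁ δ₂} → ∣ x ∣ ℚ.≤ B → ∣ y ℚ.- y′ ∣ ℚ.≤ δ₁ →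
          ∣ y′ ∣ ℚ.≤ C → ∣ x ℚ.- x′ ∣ ℚ.≤ δ₂ →
          ∣ x ℚ.* y ℚ.- x′ ℚ.* y′ ∣ ℚ.≤ B ℚ.* δ₁ ℚ.+ C ℚ.* δ₂
*-close {x} {y} {x′} {y′} {B} {C} {δ₁} {δ₂} x≤ y-y′≤ y′≤ x-x′≤ = begin
  ∣ x ℚ.* y ℚ.- x′ ℚ.* y′ ∣
    ≡⟨ cong ∣_∣ (*-split x y x′ y′) ⟩
  ∣ x ℚ.* (y ℚ.- y′) ℚ.+ y′ ℚ.* (x ℚ.- x′) ∣
    ≤⟨ ℚ.∣p+q∣≤∣p∣+∣q∣ (x ℚ.* (y ℚ.- y′)) (y′ ℚ.* (x ℚ.- x′)) ⟩
  ∣ x ℚ.* (y ℚ.- y′) ∣ ℚ.+ ∣ y′ ℚ.* (x ℚ.- x′) ∣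
    ≤⟨ ℚ.+-mono-≤ (*-mono-∣∣ x (y ℚ.- y′) x≤ y-y′≤) (*-mono-∣∣ y′ (x ℚ.- x′) y′≤ x-x′≤) ⟩
  B ℚ.* δ₁ ℚ.+ C ℚ.* δ₂ ∎
  where open ℚ.≤-Reasoning

*-cauchy : ∀ {x y} → IsCauchy x → IsCauchy y → IsCauchy (λ n → x n ℚ.* y n)
*-cauchy {x} {y} cx cy δ 0<δ =
  let N₁ , B , 0<B , x≤B = bounded {x} cx
      N₂ , C , 0<C , y≤C = bounded {y} cy
      δ₁ , 0<δ₁ , eq₁ = quotient B 0<B (½ ℚ.* δ) (half>0 0<δ)
      δ₂ , 0<δ₂ , eq₂ = quotient C 0<C (½ ℚ.* δ) (half>0 0<δ)
      N₃ , h₁ = cy δ₁ 0<δ₁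
      N₄ , h₂ = cx δ₂ 0<δ₂
      L = N₁ ℕ.⊔ N₂
      R = N₃ ℕ.⊔ N₄
  in L ℕ.⊔ R , λ m n N≤m N≤n →
    let L≤m = ℕ.m⊔n≤o⇒m≤o L R N≤m
        L≤n = ℕ.m⊔n≤o⇒m≤o L R N≤n
        R≤m = ℕ.m⊔n≤o⇒n≤o L R N≤m
        R≤n = ℕ.m⊔n≤o⇒n≤o L R N≤n
    in subst (∣ x m ℚ.* y m ℚ.- x n ℚ.* y n ∣ ℚ.≤_)
         (trans (cong₂ ℚ._+_ eq₁ eq₂) (half+half δ))
         (*-close {x m} {y m} {x n} {y n}
           (x≤B m (ℕ.m⊔n≤o⇒m≤o N₁ N₂ L≤m))
           (h₁ m n (ℕ.m⊔n≤o⇒m≤o N₃ N₄ R≤m) (ℕ.m⊔n≤o⇒m≤o N₃ N₄ R≤n))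
           (y≤C n (ℕ.m⊔n≤o⇒n≤o N₁ N₂ L≤n))
           (h₂ m n (ℕ.m⊔n≤o⇒n≤o N₃ N₄ R≤m) (ℕ.m⊔n≤o⇒n≤o N₃ N₄ R≤n)))

infixl 6 _+ℝ_
infixl 7 _*ℝ_

_+ℝ_ : ℝ → ℝ → ℝ
mkℝ x cx +ℝ mkℝ y cy = mkℝ (λ n → x n ℚ.+ y n) (+-cauchy {x} {y} cx cy)

_*ℝ_ : ℝ → ℝ → ℝ
mkℝ x cx *ℝ mkℝ y cy = mkℝ (λ n → x n ℚ.* y n) (*-cauchy {x} {y} cx cy)

_⟶0 : (ℕ → ℝ) → Set
ε ⟶0 = ∀ δ → 0ℚ ℚ.< δ →
  ∃ λ N → ∀ n → N ℕ.≤ n → fromℚ (ℚ.- δ) ≤ℝ ε n × ε n ≤ℝ fromℚ δ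

rate⇒cauchy : ∀ {x} →
  (∀ m n → m ℕ.≤ n → ∣ x (suc m) ℚ.- x (suc n) ∣ ℚ.≤ (+ 1) ℚ./ suc m) → IsCauchy x
rate⇒cauchy {x} rate δ 0<δ with N , 1/N≤δ ← archimedean δ 0<δ = suc N , close
  where
  below : ∀ {m n} → N ℕ.≤ m → m ℕ.≤ n → ∣ x (suc m) ℚ.- x (suc n) ∣ ℚ.≤ δ
  below {m} {n} N≤m m≤n = ℚ.≤-trans (rate m n m≤n)
    (ℚ.≤-trans (frac-≤ 1 (suc m) 1 (suc N) (ℕ.*-monoʳ-≤ 1 (s≤s N≤m))) 1/N≤δ)
  close : ∀ m n → suc N ℕ.≤ m → suc N ℕ.≤ n → ∣ x m ℚ.- x n ∣ ℚ.≤ δ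
  close (suc m) (suc n) (s≤s N≤m) (s≤s N≤n) with ℕ.≤-total m n
  ... | inj₁ m≤n = below N≤m m≤n
  ... | inj₂ n≤m = subst (ℚ._≤ δ) (∣-∣-sym (x (suc n)) (x (suc m))) (below N≤n n≤m)

1/_! : ℕ → ℚ
1/ n ! = ℚ._/_ (+ 1) (n !) {{n !≢0}}

expSum : ℕ → ℚ
expSum zero    = 1/ 0 !
expSum (suc n) = expSum n ℚ.+ 1/ suc n !

0≤1/n! : ∀ n → 0ℚ ℚ.≤ 1/ n !
0≤1/n! n = frac-≤ 0 1 1 (n !) {{_}} {{n !≢0}} z≤n

expSum-mono : ∀ {m n} → m ℕ.≤′ n → expSum m ℚ.≤ expSum n
expSum-mono ℕ.≤′-refl = ℚ.≤-refl
expSum-mono {m} {suc n} (ℕ.≤′-step m≤n) = ℚ.≤-trans (expSum-mono m≤n)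
  (subst (ℚ._≤ expSum (suc n)) (ℚ.+-identityʳ (expSum n))
    (ℚ.+-monoʳ-≤ (expSum n) (0≤1/n! (suc n))))

upper : ℕ → ℚ
upper n = expSum n ℚ.+ 1/ n !

upper-step : ∀ n → upper (suc (suc n)) ℚ.≤ upper (suc n)
upper-step n = begin
  expSum k ℚ.+ 1/ suc k ! ℚ.+ 1/ suc k !
    ≡⟨ ℚ.+-assoc (expSum k) (1/ suc k !) (1/ suc k !) ⟩
  expSum k ℚ.+ (1/ suc k ! ℚ.+ 1/ suc k !)
    ≡⟨ cong (expSum k ℚ.+_) (frac-+ 1 1 (suc k !) {{suc k !≢0}}) ⟩
  expSum k ℚ.+ ℚ._/_ (+ 2) (suc k !) {{suc k !≢0}}
    ≤⟨ ℚ.+-monoʳ-≤ (expSum k) (frac-≤ 2 (suc k !) 1 (k !) {{suc k !≢0}} {{k !≢0}}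
         (subst (2 ℕ.* k ! ℕ.≤_) (sym (ℕ.*-identityˡ (suc k !)))
           (ℕ.*-monoˡ-≤ (k !) (s≤s (s≤s (z≤n {n})))))) ⟩
  expSum k ℚ.+ 1/ k ! ∎
  where
  open ℚ.≤-Reasoning
  k = suc n

upper-anti : ∀ {m n} → m ℕ.≤′ n → upper (suc n) ℚ.≤ upper (suc m)
upper-anti ℕ.≤′-refl = ℚ.≤-refl
upper-anti {n = suc n} (ℕ.≤′-step m≤n) = ℚ.≤-trans (upper-step n) (upper-anti m≤n)

n≤n! : ∀ n → n ℕ.≤ n !
n≤n! zero    = z≤n
n≤n! (suc n) = subst (ℕ._≤ suc n !) (ℕ.*-identityʳ (suc n)) (ℕ.*-monoʳ-≤ (suc n) (ℕ.1≤n! n))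

expSum-rate : ∀ m n → m ℕ.≤ n →
              ∣ expSum (suc m) ℚ.- expSum (suc n) ∣ ℚ.≤ (+ 1) ℚ./ suc m
expSum-rate m n m≤n = ∣-∣-≤ {expSum (suc m)} {expSum (suc n)}
  (ℚ.≤-trans (expSum-mono (ℕ.≤⇒≤′ (s≤s m≤n)))
    (subst (ℚ._≤ expSum (suc n) ℚ.+ (+ 1) ℚ./ suc m) (ℚ.+-identityʳ (expSum (suc n)))
      (ℚ.+-monoʳ-≤ (expSum (suc n)) (frac-≤ 0 1 1 (suc m) z≤n))))
  (begin
    expSum (suc n)
      ≡⟨ ℚ.+-identityʳ (expSum (suc n)) ⟨
    expSum (suc n) ℚ.+ 0ℚ
      ≤⟨ ℚ.+-monoʳ-≤ (expSum (suc n)) (0≤1/n! (suc n)) ⟩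
    upper (suc n)
      ≤⟨ upper-anti (ℕ.≤⇒≤′ m≤n) ⟩
    expSum (suc m) ℚ.+ 1/ suc m !
      ≤⟨ ℚ.+-monoʳ-≤ (expSum (suc m)) (frac-≤ 1 (suc m !) 1 (suc m) {{suc m !≢0}}
           (ℕ.*-monoʳ-≤ 1 (n≤n! (suc m)))) ⟩
    expSum (suc m) ℚ.+ (+ 1) ℚ./ suc m ∎)
  where open ℚ.≤-Reasoning

-- Σ 1/i!
e : ℝ
e = mkℝ expSum (rate⇒cauchy {expSum} expSum-rate)

-- ⌊√n⌋
isqrt : ℕ → ℕ
isqrt zero = 0
isqrt (suc n) with suc (isqrt n) ℕ.* suc (isqrt n) ℕ.≤? suc n
... | yes _ = suc (isqrt n)
... | no  _ = isqrt n

isqrt-lower : ∀ n → isqrt n ℕ.* isqrt n ℕ.≤ n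
isqrt-lower zero = z≤n
isqrt-lower (suc n) with suc (isqrt n) ℕ.* suc (isqrt n) ℕ.≤? suc n
... | yes le = le
... | no  _  = ℕ.m≤n⇒m≤1+n (isqrt-lower n)

isqrt-upper : ∀ n → n ℕ.< suc (isqrt n) ℕ.* suc (isqrt n)
isqrt-upper zero = s≤s z≤n
isqrt-upper (suc n) with suc (isqrt n) ℕ.* suc (isqrt n) ℕ.≤? suc n
... | yes _  = ℕ.≤-<-trans (isqrt-upper n)
                 (ℕ.*-mono-< (ℕ.n<1+n (suc (isqrt n))) (ℕ.n<1+n (suc (isqrt n))))
... | no ¬le = ℕ.≰⇒> ¬le

-- The largest a with (a / suc n)² ≤ q.
√-numerator : ℚ → ℕ → ℕ
√-numerator q n = isqrt (ℤ.∣ ↥ q ∣ ℕ.* (suc n ℕ.* suc n) ℕ./ ↧ₙ q)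

√-approx : ℚ → ℕ → ℚ
√-approx q n = (+ √-numerator q n) ℚ./ suc n

m<[1+m/n]*n : ∀ m n .{{_ : NonZero n}} → m ℕ.< suc (m ℕ./ n) ℕ.* n
m<[1+m/n]*n m n = begin-strict
  m                              ≡⟨ ℕ.m≡m%n+[m/n]*n m n ⟩
  m ℕ.% n ℕ.+ (m ℕ./ n) ℕ.* n    <⟨ ℕ.+-monoˡ-< _ (ℕ.m%n<n m n) ⟩
  suc (m ℕ./ n) ℕ.* n            ∎
  where open ℕ.≤-Reasoning

√-numerator-lower : ∀ q n → √-numerator q n ℕ.* √-numerator q n ℕ.* ↧ₙ q
                            ℕ.≤ ℤ.∣ ↥ q ∣ ℕ.* (suc n ℕ.* suc n)
√-numerator-lower q n = ℕ.≤-trans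
  (ℕ.*-monoˡ-≤ (↧ₙ q) (isqrt-lower (x ℕ./ ↧ₙ q))) (ℕ.m/n*n≤m x (↧ₙ q))
  where x = ℤ.∣ ↥ q ∣ ℕ.* (suc n ℕ.* suc n)

√-numerator-upper : ∀ q n → ℤ.∣ ↥ q ∣ ℕ.* (suc n ℕ.* suc n) ℕ.<
                            suc (√-numerator q n) ℕ.* suc (√-numerator q n) ℕ.* ↧ₙ q
√-numerator-upper q n = ℕ.<-≤-trans (m<[1+m/n]*n x (↧ₙ q))
  (ℕ.*-monoˡ-≤ (↧ₙ q) (isqrt-upper (x ℕ./ ↧ₙ q)))
  where x = ℤ.∣ ↥ q ∣ ℕ.* (suc n ℕ.* suc n)

square-cancel-< : ∀ {a b} → a ℕ.* a ℕ.< b ℕ.* b → a ℕ.< b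
square-cancel-< {a} {b} lt with a ℕ.<? b
... | yes a<b = a<b
... | no  a≮b = ⊥-elim (ℕ.<⇒≱ lt (ℕ.*-mono-≤ (ℕ.≮⇒≥ a≮b) (ℕ.≮⇒≥ a≮b)))

√-cross : ∀ q m n → √-numerator q m ℕ.* suc n ℕ.< suc (√-numerator q n) ℕ.* suc m
√-cross q m n = square-cancel-< (ℕ.*-cancelʳ-< _ _ _ (begin-strict
  (a ℕ.* N) ℕ.* (a ℕ.* N) ℕ.* d    ≡⟨ lemma₁ a N d ⟩
  (a ℕ.* a ℕ.* d) ℕ.* (N ℕ.* N)    ≤⟨ ℕ.*-monoˡ-≤ (N ℕ.* N) (√-numerator-lower q m) ⟩
  (p ℕ.* (M ℕ.* M)) ℕ.* (N ℕ.* N)  ≡⟨ lemma₂ p (M ℕ.* M) (N ℕ.* N) ⟩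
  (p ℕ.* (N ℕ.* N)) ℕ.* (M ℕ.* M)  <⟨ ℕ.*-monoˡ-< (M ℕ.* M) (√-numerator-upper q n) ⟩
  (b ℕ.* b ℕ.* d) ℕ.* (M ℕ.* M)    ≡⟨ lemma₁ b M d ⟨
  (b ℕ.* M) ℕ.* (b ℕ.* M) ℕ.* d    ∎))
  where
  open ℕ.≤-Reasoning
  p = ℤ.∣ ↥ q ∣
  d = ↧ₙ q
  M = suc m
  N = suc n
  a = √-numerator q m
  b = suc (√-numerator q n)
  lemma₁ : ∀ a N d → (a ℕ.* N) ℕ.* (a ℕ.* N) ℕ.* d ≡ (a ℕ.* a ℕ.* d) ℕ.* (N ℕ.* N)
  lemma₁ = solve-∀
  lemma₂ : ∀ p x y → (p ℕ.* x) ℕ.* y ≡ (p ℕ.* y) ℕ.* x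
  lemma₂ = solve-∀

√-diff : ∀ q m n → √-approx q m ℚ.≤ √-approx q n ℚ.+ (+ 1) ℚ./ suc n
√-diff q m n = begin
  √-approx q m                                  ≤⟨ frac-≤ (√-numerator q m) (suc m) (b ℕ.+ 1) (suc n) le ⟩
  (+ (b ℕ.+ 1)) ℚ./ suc n                       ≡⟨ frac-+ b 1 (suc n) ⟨
  √-approx q n ℚ.+ (+ 1) ℚ./ suc n              ∎
  where
  open ℚ.≤-Reasoning
  b = √-numerator q n
  le : √-numerator q m ℕ.* suc n ℕ.≤ (b ℕ.+ 1) ℕ.* suc m
  le = subst (λ c → √-numerator q m ℕ.* suc n ℕ.≤ c ℕ.* suc m) (ℕ.+-comm 1 b) (ℕ.<⇒≤ (√-cross q m n))

1/-anti : ∀ {m n} → m ℕ.≤ n → (+ 1) ℚ./ suc n ℚ.≤ (+ 1) ℚ./ suc m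
1/-anti {m} {n} m≤n = frac-≤ 1 (suc n) 1 (suc m) (ℕ.*-monoʳ-≤ 1 (s≤s m≤n))

√-rate : ∀ q m n → m ℕ.≤ n →
         ∣ √-approx q (suc m) ℚ.- √-approx q (suc n) ∣ ℚ.≤ (+ 1) ℚ./ suc m
√-rate q m n m≤n = ∣-∣-≤ {√-approx q (suc m)} {√-approx q (suc n)}
  (ℚ.≤-trans (√-diff q (suc m) (suc n))
    (ℚ.+-monoʳ-≤ (√-approx q (suc n)) (1/-anti (ℕ.m≤n⇒m≤1+n m≤n))))
  (ℚ.≤-trans (√-diff q (suc n) (suc m))
    (ℚ.+-monoʳ-≤ (√-approx q (suc m)) (1/-anti (ℕ.n≤1+n m))))

√_ : (q : ℚ) → .{{ℚ.NonNegative q}} → ℝ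
√ q = mkℝ (√-approx q) (rate⇒cauchy {√-approx q} (√-rate q))

√-numerator-bound : ∀ q n → √-numerator q n ℕ.≤ ℤ.∣ ↥ q ∣ ℕ.* suc n
√-numerator-bound q n = ℕ.≮⇒≥ λ lt → ℕ.<⇒≱ (ℕ.*-mono-< lt lt) (begin
  a ℕ.* a                          ≤⟨ ℕ.m≤m*n (a ℕ.* a) (↧ₙ q) ⟩
  a ℕ.* a ℕ.* ↧ₙ q                 ≤⟨ √-numerator-lower q n ⟩
  p ℕ.* (suc n ℕ.* suc n)          ≤⟨ p≤p*p p ⟩
  p ℕ.* p ℕ.* (suc n ℕ.* suc n)    ≡⟨ lemma p (suc n) ⟩
  p ℕ.* suc n ℕ.* (p ℕ.* suc n)    ∎)
  where
  open ℕ.≤-Reasoning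
  a = √-numerator q n
  p = ℤ.∣ ↥ q ∣
  p≤p*p : ∀ p → p ℕ.* (suc n ℕ.* suc n) ℕ.≤ p ℕ.* p ℕ.* (suc n ℕ.* suc n)
  p≤p*p zero      = z≤n
  p≤p*p p@(suc _) = ℕ.*-monoˡ-≤ (suc n ℕ.* suc n) (ℕ.m≤m*n p p)
  lemma : ∀ p N → p ℕ.* p ℕ.* (N ℕ.* N) ≡ p ℕ.* N ℕ.* (p ℕ.* N)
  lemma = solve-∀

∣q∣/d≡q : ∀ q → .{{ℚ.NonNegative q}} → (+ ℤ.∣ ↥ q ∣) ℚ./ ↧ₙ q ≡ q
∣q∣/d≡q q@(mkℚ (+ _) _ _) = ℚ.↥p/↧p≡p q

√-square-lower : ∀ q n → .{{ℚ.NonNegative q}} → √-approx q n ℚ.* √-approx q n ℚ.≤ q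
√-square-lower q n = begin
  √-approx q n ℚ.* √-approx q n             ≡⟨ frac-* a (suc n) ⟩
  (+ (a ℕ.* a)) ℚ./ (suc n ℕ.* suc n)       ≤⟨ frac-≤ (a ℕ.* a) (suc n ℕ.* suc n) ℤ.∣ ↥ q ∣ (↧ₙ q) (√-numerator-lower q n) ⟩
  (+ ℤ.∣ ↥ q ∣) ℚ./ ↧ₙ q                    ≡⟨ ∣q∣/d≡q q ⟩
  q                                         ∎
  where
  open ℚ.≤-Reasoning
  a = √-numerator q n

√-square-upper : ∀ q n → .{{ℚ.NonNegative q}} →
  q ℚ.≤ √-approx q n ℚ.* √-approx q n ℚ.+ (+ (1 ℕ.+ 2 ℕ.* ℤ.∣ ↥ q ∣)) ℚ./ suc n
√-square-upper q n = begin
  q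
    ≡⟨ ∣q∣/d≡q q ⟨
  (+ p) ℚ./ ↧ₙ q
    ≤⟨ frac-≤ p (↧ₙ q) (a ℕ.* a ℕ.+ (1 ℕ.+ 2 ℕ.* p) ℕ.* N) (N ℕ.* N) le ⟩
  (+ (a ℕ.* a ℕ.+ (1 ℕ.+ 2 ℕ.* p) ℕ.* N)) ℚ./ (N ℕ.* N)
    ≡⟨ frac-+ (a ℕ.* a) ((1 ℕ.+ 2 ℕ.* p) ℕ.* N) (N ℕ.* N) ⟨
  (+ (a ℕ.* a)) ℚ./ (N ℕ.* N) ℚ.+ (+ ((1 ℕ.+ 2 ℕ.* p) ℕ.* N)) ℚ./ (N ℕ.* N)
    ≡⟨ cong₂ ℚ._+_ (sym (frac-* a N))
         (frac-≡ ((1 ℕ.+ 2 ℕ.* p) ℕ.* N) (N ℕ.* N) (1 ℕ.+ 2 ℕ.* p) N (ℕ.*-assoc (1 ℕ.+ 2 ℕ.* p) N N)) ⟩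
  √-approx q n ℚ.* √-approx q n ℚ.+ (+ (1 ℕ.+ 2 ℕ.* p)) ℚ./ N ∎
  where
  N = suc n
  a = √-numerator q n
  p = ℤ.∣ ↥ q ∣
  expand : ∀ a → suc a ℕ.* suc a ≡ a ℕ.* a ℕ.+ (1 ℕ.+ 2 ℕ.* a)
  expand = solve-∀
  collect : ∀ p N → N ℕ.+ 2 ℕ.* (p ℕ.* N) ≡ (1 ℕ.+ 2 ℕ.* p) ℕ.* N
  collect = solve-∀
  square : suc a ℕ.* suc a ℕ.≤ a ℕ.* a ℕ.+ (1 ℕ.+ 2 ℕ.* p) ℕ.* N
  square = begin
    suc a ℕ.* suc a                            ≡⟨ expand a ⟩
    a ℕ.* a ℕ.+ (1 ℕ.+ 2 ℕ.* a)                ≤⟨ ℕ.+-monoʳ-≤ (a ℕ.* a) (ℕ.+-mono-≤ (s≤s (z≤n {n}))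
                                                   (ℕ.*-monoʳ-≤ 2 (√-numerator-bound q n))) ⟩
    a ℕ.* a ℕ.+ (N ℕ.+ 2 ℕ.* (p ℕ.* N))        ≡⟨ cong (a ℕ.* a ℕ.+_) (collect p N) ⟩
    a ℕ.* a ℕ.+ (1 ℕ.+ 2 ℕ.* p) ℕ.* N          ∎
    where open ℕ.≤-Reasoning
  le : p ℕ.* (N ℕ.* N) ℕ.≤ (a ℕ.* a ℕ.+ (1 ℕ.+ 2 ℕ.* p) ℕ.* N) ℕ.* ↧ₙ q
  le = ℕ.≤-trans (ℕ.<⇒≤ (√-numerator-upper q n)) (ℕ.*-monoˡ-≤ (↧ₙ q) square)
  open ℚ.≤-Reasoning

archimedean* : ∀ c δ → 0ℚ ℚ.< δ → ∃ λ N → (+ c) ℚ./ suc N ℚ.≤ δ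
archimedean* c δ 0<δ with N , 1/N≤δ ← archimedean δ 0<δ = M ,
  ℚ.≤-trans (frac-≤ c (suc M) 1 (suc N) (begin
    c ℕ.* suc N               ≤⟨ ℕ.m≤n+m _ (suc M ℕ.∸ c ℕ.* suc N) ⟩
    suc M ℕ.∸ c ℕ.* suc N ℕ.+ c ℕ.* suc N   ≡⟨ ℕ.m∸n+n≡m (ℕ.n≤1+n M) ⟩
    suc M                     ≡⟨ ℕ.*-identityˡ (suc M) ⟨
    1 ℕ.* suc M               ∎)) 1/N≤δ
  where
  open ℕ.≤-Reasoning
  M = c ℕ.* suc N

√-square : ∀ q .{{_ : ℚ.NonNegative q}} → √ q *ℝ √ q ≃ℝ fromℚ q
√-square q =
  (λ δ 0<δ → 0 , λ n _ → ℚ.≤-trans (√-square-lower q n)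
    (subst (ℚ._≤ q ℚ.+ δ) (ℚ.+-identityʳ q) (ℚ.+-monoʳ-≤ q (ℚ.<⇒≤ 0<δ)))) ,
  (λ δ 0<δ → let c = 1 ℕ.+ 2 ℕ.* ℤ.∣ ↥ q ∣ ; N , c/N≤δ = archimedean* c δ 0<δ in
    N , λ n N≤n → ℚ.≤-trans (√-square-upper q n)
      (ℚ.+-monoʳ-≤ (√-approx q n ℚ.* √-approx q n)
        (ℚ.≤-trans (frac-≤ c (suc n) c (suc N) (ℕ.*-monoʳ-≤ c (s≤s N≤n))) c/N≤δ)))

√-nonNegative : ∀ q .{{_ : ℚ.NonNegative q}} → fromℚ 0ℚ ≤ℝ √ q
√-nonNegative q δ 0<δ = 0 , λ n _ → ℚ.≤-trans (ℚ.<⇒≤ 0<δ)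
  (subst (ℚ._≤ √-approx q n ℚ.+ δ) (ℚ.+-identityˡ δ)
    (ℚ.+-monoˡ-≤ δ (frac-≤ 0 1 (√-numerator q n) (suc n) z≤n)))

√[_/_] : ∀ n d → .{{NonZero d}} → ℝ
√[ n / d ] = (√ ((+ n) ℚ./ d)) {{ℚ.normalize-nonNeg n d}}

-- The vertices are 0 < 1 < ⋯ < m-1.
OrderedGraph : ℕ → Set
OrderedGraph m = Vec (Vec Bool m) m

Edge : ∀ {m} → OrderedGraph m → Fin m → Fin m → Set
Edge G i j = T (lookup (lookup G i) j)

edge? : ∀ {m} (G : OrderedGraph m) i j → Dec (Edge G i j)
edge? G i j = T? (lookup (lookup G i) j)

IsSimple : ∀ {m} → OrderedGraph m → Set
IsSimple G = (∀ i j → Edge G i j → Edge G j i) × (∀ i → ¬ Edge G i i)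

-- Each edge is listed once, as (smaller endpoint , larger endpoint).
edges : ∀ {m} → OrderedGraph m → List (Fin m × Fin m)
edges {m} G = filter (λ (i , j) → (i Fin.<? j) ×-dec edge? G i j)
                     (cartesianProduct (allFin m) (allFin m))

VertexDisjoint : ∀ {m} → Fin m × Fin m → Fin m × Fin m → Set
VertexDisjoint (i , j) (k , l) = i ≢ k × i ≢ l × j ≢ k × j ≢ l

IsMatching : ∀ n → OrderedGraph (2 ℕ.* n) → Set
IsMatching n G = IsSimple G × length (edges G) ≡ n × AllPairs VertexDisjoint (edges G)

record OrderedMatching (n : ℕ) : Set where
  field
    graph      : OrderedGraph (2 ℕ.* n)
    isMatching : IsMatching n graph

open OrderedMatching public

StrictlyIncreasing : ∀ {l m} → (Fin l → Fin m) → Set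
StrictlyIncreasing w = ∀ {i j} → i Fin.< j → w i Fin.< w j

restrict : ∀ {l m} → OrderedGraph m → (Fin l → Fin m) → OrderedGraph l
restrict G w = tabulate λ i → tabulate λ j → lookup (lookup G (w i)) (w j)

OrderIsomorphic : ∀ {m} → OrderedGraph m → OrderedGraph m → Set
OrderIsomorphic G H = ∀ {i j} → i Fin.< j → Edge G i j ⇔ Edge H i j

infix 4 _≼_

-- A sub-matching of G is G restricted to the endpoints of some of its edges,
-- so it is determined by its vertices w 0 < w 1 < ⋯ .
_≼_ : ∀ {k n} → OrderedMatching k → OrderedMatching n → Set
_≼_ {k} {n} H G = Σ[ w ∈ (Fin (2 ℕ.* k) → Fin (2 ℕ.* n)) ]
  StrictlyIncreasing w × OrderIsomorphic (graph H) (restrict (graph G) w)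

IsMaximum : (ℕ → Set) → ℕ → Set
IsMaximum P m = P m × (∀ k → P k → k ℕ.≤ m)

isSimple? : ∀ {m} (G : OrderedGraph m) → Dec (IsSimple G)
isSimple? G = Fin.all? (λ i → Fin.all? λ j → edge? G i j →-dec edge? G j i)
        ×-dec Fin.all? (λ i → ¬? (edge? G i i))

isMatching? : ∀ n (G : OrderedGraph (2 ℕ.* n)) → Dec (IsMatching n G)
isMatching? n G = isSimple? G ×-dec (length (edges G) ℕ.≟ n) ×-dec
  allPairs? (λ (i , j) (k , l) →
    ¬? (i Fin.≟ k) ×-dec ¬? (i Fin.≟ l) ×-dec ¬? (j Fin.≟ k) ×-dec ¬? (j Fin.≟ l)) (edges G)

vectors : ∀ {A : Set} → List A → ∀ n → List (Vec A n)
vectors xs zero    = [] ∷ []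
vectors xs (suc n) = cartesianProductWith _∷_ xs (vectors xs n)

graphs : ∀ m → List (OrderedGraph m)
graphs m = vectors (vectors (true ∷ false ∷ []) m) m

matching? : ∀ n → OrderedGraph (2 ℕ.* n) → Maybe (OrderedMatching n)
matching? n G = Maybe.map (λ p → record { graph = G ; isMatching = p })
                          (dec⇒maybe (isMatching? n G))

matchings : ∀ n → List (OrderedMatching n)
matchings n = mapMaybe (matching? n) (graphs (2 ℕ.* n))

vectors-complete : ∀ {A : Set} {xs : List A} → (∀ x → x ∈ xs) →
                   ∀ {n} (v : Vec A n) → v ∈ vectors xs n
vectors-complete all []      = here refl
vectors-complete all (x ∷ v) =
  ∈.∈-cartesianProductWith⁺ _∷_ (all x) (vectors-complete all v)

vectors-unique : ∀ {A : Set} {xs : List A} → Unique xs → ∀ n → Unique (vectors xs n)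
vectors-unique uniq zero    = [] ∷ []
vectors-unique uniq (suc n) =
  Unique.cartesianProductWith⁺ _∷_ Vec.∷-injective uniq (vectors-unique uniq n)

graphs-complete : ∀ {m} (G : OrderedGraph m) → G ∈ graphs m
graphs-complete = vectors-complete (vectors-complete λ where
  true  → here refl
  false → there (here refl))

graphs-unique : ∀ m → Unique (graphs m)
graphs-unique m =
  vectors-unique (vectors-unique (((λ ()) ∷ []) ∷ [] ∷ []) m) m

-- The value for an empty sample space is a convention; `matchings n` is never empty.
ratio : ℕ → ℕ → ℚ
ratio a zero      = 0ℚ
ratio a b@(suc _) = (+ a) ℚ./ b

Pr : ∀ {A : Set} → List A → (A → Bool) → ℚ
Pr Ω D = ratio (length (filter (T? ∘ D) Ω)) (length Ω)

-- Constructively an event need not be decidable, so that it has no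
-- well-defined rational probability; a lower bound on its probability
-- is one on the probability of a decidable event contained in it.
-- For decidable E this says p ≤ Pr Ω E.
PrAtLeast : ∀ {A : Set} → ℚ → List A → (A → Set) → Set
PrAtLeast {A} p Ω E = Σ[ D ∈ (A → Bool) ]
  (∀ x → x ∈ Ω → T (D x) → E x) × p ℚ.≤ Pr Ω D

AsymptoticallyAlmostSurely : (∀ n → OrderedMatching n → Set) → Set
AsymptoticallyAlmostSurely E = ∀ δ → 0ℚ ℚ.< δ →
  ∃ λ N → ∀ n → N ℕ.≤ n → PrAtLeast (1ℚ ℚ.- δ) (matchings n) (E n)

{-# OPTIONS --safe #-}

-- First moment method. For a set F of j disjoint pairs and a vertex u outside F, the
-- matchings containing F and the pair {u,v} are equally numerous for all 2n − 2j − 1 free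
-- vertices v, since relabelling by a transposition exchanges any two of them. Hence k
-- prescribed disjoint edges occur with probability at most 1/((2n−1)(2n−3)⋯(2n−2k+1)),
-- and the union bound over the C(2n,2k) vertex sets gives P(M_k ≼ RM_n) ≤ (2n)ᵏ/(2k)!.
-- As j! ≥ (j/e)ʲ, this is at most (1+ε)⁻²ᵏ once k > (1+ε) e √(n/2). With ε = 1/T and
-- T ≈ n^{1/8}, such k exceed a constant times T⁴, so each of these at most n < T⁸
-- probabilities is at most T⁻⁹, and together they are at most 1/T.
module Submission where

open import Defs
open import Data.Bool.Base as Bool using (Bool)
open import Data.Bool.Properties using (T?)
open import Data.Empty using (⊥; ⊥-elim)
open import Data.Fin.Base as Fin using (Fin; zero; suc; lift)
open import Data.Fin.Permutation.Components using (transpose)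
import Data.Fin.Properties as Fin
open import Data.Integer.Base as ℤ using (∣_∣)
import Data.Integer.Properties as ℤ
open import Data.List.Base
  using (List; []; _∷_; _++_; map; length; filter; mapMaybe; cartesianProduct; allFin; upTo)
open import Data.List.Membership.Propositional using (_∈_; _∉_; find; lose)
import Data.List.Membership.Propositional.Properties as ∈
import Data.List.Properties as List
open import Data.List.Relation.Binary.Subset.Propositional using (_⊆_)
open import Data.List.Relation.Unary.All as All using (All; []; _∷_)
import Data.List.Relation.Unary.All.Properties as All
open import Data.List.Relation.Unary.AllPairs as AllPairs using (AllPairs; []; _∷_)
import Data.List.Relation.Unary.AllPairs.Properties as AllPairs
open import Data.List.Relation.Unary.Any as Any using (Any; here; there)
import Data.List.Relation.Unary.Any.Properties as Any
open import Data.List.Relation.Unary.Unique.Propositional using (Unique)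
import Data.List.Relation.Unary.Unique.Propositional.Properties as Unique
import Data.Maybe.Base as Maybe
open import Data.Nat.Base as ℕ
  using (ℕ; zero; suc; NonZero; _+_; _*_; _∸_; _^_; _!; _⊔_; _≤_; _<_; z≤n; s≤s)
open import Data.Nat.Combinatorics.Base using (_P′_)
open import Data.Nat.Combinatorics.Specification using (nP′k≡n[n∸1P′k∸1])
import Data.Nat.Properties as ℕ
open import Data.Nat.Tactic.RingSolver using (solve-∀)
open import Data.Product.Base using (Σ-syntax; ∃; _×_; _,_; proj₁; proj₂; uncurry)
open import Data.Rational.Base as ℚ using (ℚ; 0ℚ; 1ℚ; ↥_; ↧ₙ_)
import Data.Rational.Properties as ℚ
open import Data.Rational.Unnormalised.Base as ℚᵘ using (mkℚᵘ)
import Data.Rational.Unnormalised.Properties as ℚᵘ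
open import Data.Sum.Base using (_⊎_; inj₁; inj₂; [_,_]′)
import Data.Vec.Base as Vec
import Data.Vec.Properties as Vec
open import Function.Base using (_∘_; id)
open import Function.Bundles using (_⇔_; mk⇔; Equivalence)
open import Level using (0ℓ)
open import Relation.Binary.Definitions using (tri<; tri≈; tri>)
open import Relation.Binary.PropositionalEquality
  using (_≡_; _≢_; _≗_; refl; sym; trans; cong; cong₂; subst; subst₂; ≢-sym)
open import Relation.Nullary.Decidable
  using (Dec; yes; no; ⌊_⌋; toWitness; fromWitness; dec⇒maybe; map′; decidable-stable;
         _×-dec_; _→-dec_; ¬?)
open import Relation.Nullary.Negation using (¬_; contradiction)
open import Relation.Unary using (Pred; Decidable)

-- Counting in lists

-- Until the very end, every bound on a probability is a cross-multiplied inequality in ℕ, and the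
-- number (2n)!/(n! 2ⁿ) never appears. The bound (2n)ᵏ/(2k)! arises as follows: C(2n,2k) (2k)! = 2n
-- (2n - 1)⋯(2n - 2k + 1), whose factors 2n - 1, 2n - 3, ... cancel against the probability of k
-- prescribed edges, and whose other factors are at most 2n. Inequalities between Cauchy reals are
-- not decidable, so the event to be counted must not mention e. Its threshold uses a partial sum
-- P/Q of Σ 1/i! instead and is decided in ℕ after squaring. Truncation at 2n is sound on both
-- sides: j! ≥ (jQ/P)ʲ holds for all j ≤ 2n, in particular for j = 2k with k ≤ n, and P/Q ≤ e, so a
-- bound with P/Q implies the bound with e. As (1 + 1/T)ᵀ ≥ 2 and 2ᵀ ≥ T, already 9T² factors 1 +
-- 1/T yield T⁹; a number of factors of order T⁴ leaves ample room.

private variable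
  A I : Set

unique-⊆⇒length≤ : {xs ys : List A} → Unique xs → xs ⊆ ys → length xs ≤ length ys
unique-⊆⇒length≤ {xs = []} _ _ = z≤n
unique-⊆⇒length≤ {xs = x ∷ xs} (x∉xs ∷ uniq) sub
  with as , bs , refl ← ∈.∈-∃++ (sub (here refl)) = begin
    suc (length xs)            ≤⟨ s≤s (unique-⊆⇒length≤ uniq λ y∈xs → remove y∈xs) ⟩
    suc (length (as ++ bs))    ≡⟨ cong suc (List.length-++ as) ⟩
    suc (length as + length bs) ≡⟨ ℕ.+-suc (length as) (length bs) ⟨
    length as + suc (length bs) ≡⟨ List.length-++ as ⟨
    length (as ++ x ∷ bs)      ∎
  where
  open ℕ.≤-Reasoning
  remove : ∀ {y} → y ∈ xs → y ∈ as ++ bs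
  remove y∈xs with ∈.∈-++⁻ as (sub (there y∈xs))
  ... | inj₁ y∈as         = ∈.∈-++⁺ˡ y∈as
  ... | inj₂ (here refl)  = contradiction refl (All.lookup x∉xs y∈xs)
  ... | inj₂ (there y∈bs) = ∈.∈-++⁺ʳ as y∈bs

count : {P : Pred A 0ℓ} → Decidable P → List A → ℕ
count P? xs = length (filter P? xs)

count-mono : {P Q : Pred A 0ℓ} (P? : Decidable P) (Q? : Decidable Q) →
             (∀ x → P x → Q x) → ∀ xs → count P? xs ≤ count Q? xs
count-mono P? Q? P⊆Q [] = z≤n
count-mono P? Q? P⊆Q (x ∷ xs) with ih ← count-mono P? Q? P⊆Q xs | P? x | Q? x
... | no _  | no _  = ih
... | no _  | yes _ = ℕ.m≤n⇒m≤1+n ih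
... | yes p | no ¬q = contradiction (P⊆Q x p) ¬q
... | yes _ | yes _ = s≤s ih

count-∪ : {P Q R : Pred A 0ℓ} (P? : Decidable P) (Q? : Decidable Q) (R? : Decidable R) →
          (∀ x → R x → P x ⊎ Q x) → ∀ xs → count R? xs ≤ count P? xs + count Q? xs
count-∪ P? Q? R? sub [] = z≤n
count-∪ P? Q? R? sub (x ∷ xs) with ih ← count-∪ P? Q? R? sub xs | R? x | P? x | Q? x
... | no _  | no _  | no _  = ih
... | no _  | no _  | yes _ = ℕ.≤-trans ih (ℕ.+-monoʳ-≤ (count P? xs) (ℕ.n≤1+n _))
... | no _  | yes _ | no _  = ℕ.m≤n⇒m≤1+n ih
... | no _  | yes _ | yes _ = ℕ.m≤n⇒m≤1+n (ℕ.≤-trans ih (ℕ.+-monoʳ-≤ (count P? xs) (ℕ.n≤1+n _)))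
... | yes r | no ¬p | no ¬q = contradiction (sub x r) [ ¬p , ¬q ]′
... | yes _ | no _  | yes _ = ℕ.≤-trans (s≤s ih) (ℕ.≤-reflexive (sym (ℕ.+-suc (count P? xs) _)))
... | yes _ | yes _ | no _  = s≤s ih
... | yes _ | yes _ | yes _ = s≤s (ℕ.≤-trans ih (ℕ.+-monoʳ-≤ (count P? xs) (ℕ.n≤1+n _)))

count-⊎ : {P Q R : Pred A 0ℓ} (P? : Decidable P) (Q? : Decidable Q) (R? : Decidable R) →
          (∀ x → P x → R x) → (∀ x → Q x → R x) → (∀ x → P x → Q x → ⊥) →
          ∀ xs → count P? xs + count Q? xs ≤ count R? xs
count-⊎ P? Q? R? P⊆R Q⊆R P∩Q [] = z≤n
count-⊎ P? Q? R? P⊆R Q⊆R P∩Q (x ∷ xs)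
  with ih ← count-⊎ P? Q? R? P⊆R Q⊆R P∩Q xs | P? x | Q? x | R? x
... | no _  | no _  | no _  = ih
... | no _  | no _  | yes _ = ℕ.m≤n⇒m≤1+n ih
... | no _  | yes q | no ¬r = contradiction (Q⊆R x q) ¬r
... | no _  | yes _ | yes _ = ℕ.≤-trans (ℕ.≤-reflexive (ℕ.+-suc (count P? xs) _)) (s≤s ih)
... | yes p | no _  | no ¬r = contradiction (P⊆R x p) ¬r
... | yes _ | no _  | yes _ = s≤s ih
... | yes p | yes q | _     = ⊥-elim (P∩Q x p q)

count-complement : {P : Pred A 0ℓ} (P? : Decidable P) (xs : List A) →
                   count P? xs + count (¬? ∘ P?) xs ≡ length xs
count-complement P? [] = refl
count-complement P? (x ∷ xs) with ih ← count-complement P? xs | P? x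
... | yes _ = cong suc ih
... | no _  = trans (ℕ.+-suc (count P? xs) _) (cong suc ih)

count-∉ : (_∈?_ : (x : A) (ys : List A) → Dec (x ∈ ys)) {xs : List A} → Unique xs → ∀ ys →
          length xs ∸ length ys ≤ count (λ x → ¬? (x ∈? ys)) xs
count-∉ _∈?_ {xs} uniq ys = begin
  length xs ∸ length ys
    ≤⟨ ℕ.∸-monoʳ-≤ (length xs) (unique-⊆⇒length≤ (Unique.filter⁺ (_∈? ys) uniq)
         λ x∈ → proj₂ (∈.∈-filter⁻ (_∈? ys) {xs = xs} x∈)) ⟩
  length xs ∸ count (_∈? ys) xs
    ≡⟨ cong (_∸ count (_∈? ys) xs) (count-complement (_∈? ys) xs) ⟨
  count (_∈? ys) xs + count (λ x → ¬? (x ∈? ys)) xs ∸ count (_∈? ys) xs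
    ≡⟨ ℕ.m+n∸m≡n (count (_∈? ys) xs) _ ⟩
  count (λ x → ¬? (x ∈? ys)) xs ∎
  where open ℕ.≤-Reasoning

-- Division is avoided: `c` will be `oddProduct` or T⁹ and `b` the number of all matchings, so that
-- each event has probability at most 1/c.
union-bound : {P : I → Pred A 0ℓ} {Q : Pred A 0ℓ} (P? : ∀ i → Decidable (P i)) (Q? : Decidable Q)
              (xs : List A) (is : List I) (c b : ℕ) →
              (∀ x → Q x → Any (λ i → P i x) is) →
              All (λ i → count (P? i) xs * c ≤ b) is →
              count Q? xs * c ≤ length is * b
union-bound P? Q? xs [] c b cover [] =
  subst (λ ys → length ys * c ≤ 0)
    (sym (List.filter-none Q? (All.universal (λ x q → Any.¬Any[] (cover x q)) xs))) z≤n
union-bound {P = P} P? Q? xs (i ∷ is) c b cover (le ∷ les) = begin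
  count Q? xs * c                             ≤⟨ ℕ.*-monoˡ-≤ c (count-∪ (P? i) rest? Q? split xs) ⟩
  (count (P? i) xs + count rest? xs) * c      ≡⟨ ℕ.*-distribʳ-+ c (count (P? i) xs) _ ⟩
  count (P? i) xs * c + count rest? xs * c    ≤⟨ ℕ.+-mono-≤ le
                                                   (union-bound P? rest? xs is c b (λ _ → id) les) ⟩
  b + length is * b                           ∎
  where
  open ℕ.≤-Reasoning
  rest? = λ x → Any.any? (λ j → P? j x) is
  split : ∀ x → _ → P i x ⊎ Any (λ j → P j x) is
  split x q = Any.toSum (cover x q)

-- Counterpart of `union-bound`: exclusive events add up. It drives the exchange argument, where the
-- events are the possible partners of one vertex.
packing-bound : {P : I → Pred A 0ℓ} {Q : Pred A 0ℓ} (P? : ∀ i → Decidable (P i)) (Q? : Decidable Q)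
                (xs : List A) {is : List I} (b : ℕ) → Unique is →
                (∀ {i j} x → P i x → P j x → i ≡ j) →
                (∀ x → Any (λ i → P i x) is → Q x) →
                All (λ i → b ≤ count (P? i) xs) is →
                length is * b ≤ count Q? xs
packing-bound P? Q? xs b [] disj sub [] = z≤n
packing-bound {P = P} P? Q? xs {i ∷ is} b (i∉is ∷ uniq) disj sub (le ∷ les) =
  ℕ.≤-trans
    (ℕ.+-mono-≤ le (packing-bound P? rest? xs b uniq disj (λ _ → id) les))
    (count-⊎ (P? i) rest? Q? (λ x p → sub x (here p)) (λ x a → sub x (there a)) clash xs)
  where
  rest? = λ x → Any.any? (λ j → P? j x) is
  clash : ∀ x → P i x → Any (λ j → P j x) is → ⊥
  clash x p any with j , j∈is , q ← find any = All.lookup i∉is j∈is (disj x p q)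

-- `matchings` arises from `graphs` by attaching proofs. Counting on `graphs` frees the relabelling
-- argument from equality of these proofs.
count-mapMaybe : {M P : Pred A 0ℓ} (M? : Decidable M) (mk : ∀ x → M x → I) (proj : I → A) →
                 (∀ x p → proj (mk x p) ≡ x) → (P? : Decidable P) → ∀ xs →
                 count (P? ∘ proj) (mapMaybe (λ x → Maybe.map (mk x) (dec⇒maybe (M? x))) xs) ≡
                 count (λ x → M? x ×-dec P? x) xs
count-mapMaybe M? mk proj proj-mk P? [] = refl
count-mapMaybe M? mk proj proj-mk P? (x ∷ xs)
  with ih ← count-mapMaybe M? mk proj proj-mk P? xs | M? x
... | no _ = ih
... | yes p rewrite proj-mk x p with P? x
...   | no _  = ih
...   | yes _ = cong suc ih

-- Matchings and relabelling

edge-restrict : ∀ {l m} (G : OrderedGraph m) (w : Fin l → Fin m) i j →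
                Vec.lookup (Vec.lookup (restrict G w) i) j ≡
                Vec.lookup (Vec.lookup G (w i)) (w j)
edge-restrict G w i j = trans
  (cong (λ r → Vec.lookup r j) (Vec.lookup∘tabulate _ i)) (Vec.lookup∘tabulate _ j)

edge-restrict⁺ : ∀ {l m} (G : OrderedGraph m) (w : Fin l → Fin m) {i j} →
                 Edge G (w i) (w j) → Edge (restrict G w) i j
edge-restrict⁺ G w {i} {j} = subst Bool.T (sym (edge-restrict G w i j))

edge-restrict⁻ : ∀ {l m} (G : OrderedGraph m) (w : Fin l → Fin m) {i j} →
                 Edge (restrict G w) i j → Edge G (w i) (w j)
edge-restrict⁻ G w {i} {j} = subst Bool.T (edge-restrict G w i j)

-- Disjointness of edges seen from a vertex. Unlike the list of oriented edges, this form passes at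
-- once through an injective relabelling.
Functional : ∀ {m} → OrderedGraph m → Set
Functional G = ∀ {u v v′} → Edge G u v → Edge G u v′ → v ≡ v′

module _ {m} (G : OrderedGraph m) where

  private
    oriented? = λ ((i , j) : Fin m × Fin m) → (i Fin.<? j) ×-dec edge? G i j

  edges⁺ : ∀ {i j} → i Fin.< j → Edge G i j → (i , j) ∈ edges G
  edges⁺ {i} {j} i<j ij = ∈.∈-filter⁺ oriented?
    (∈.∈-cartesianProduct⁺ (∈.∈-allFin i) (∈.∈-allFin j)) (i<j , ij)

  edges⁻ : ∀ {i j} → (i , j) ∈ edges G → i Fin.< j × Edge G i j
  edges⁻ ij∈ = proj₂ (∈.∈-filter⁻ oriented? {xs = cartesianProduct (allFin m) (allFin m)} ij∈)

  edges-unique : Unique (edges G)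
  edges-unique = Unique.filter⁺ oriented?
    (Unique.cartesianProduct⁺ (Unique.allFin⁺ m) (Unique.allFin⁺ m))

  edge∈edges : IsSimple G → ∀ {u v} → Edge G u v → (u , v) ∈ edges G ⊎ (v , u) ∈ edges G
  edge∈edges (symm , irrefl) {u} {v} uv with Fin.<-cmp u v
  ... | tri< u<v _ _  = inj₁ (edges⁺ u<v uv)
  ... | tri≈ _ refl _ = contradiction uv (irrefl u)
  ... | tri> _ _ v<u  = inj₂ (edges⁺ v<u (symm u v uv))

allPairs-lookup : {S : A → A → Set} {xs : List A} → AllPairs S xs →
                  ∀ {x y} → x ∈ xs → y ∈ xs → x ≡ y ⊎ S x y ⊎ S y x
allPairs-lookup (_ ∷ _)   (here refl) (here refl) = inj₁ refl
allPairs-lookup (x~ ∷ _)  (here refl) (there y∈)  = inj₂ (inj₁ (All.lookup x~ y∈))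
allPairs-lookup (x~ ∷ _)  (there x∈)  (here refl) = inj₂ (inj₂ (All.lookup x~ x∈))
allPairs-lookup (_ ∷ ap)  (there x∈)  (there y∈)  = allPairs-lookup ap x∈ y∈

unique⇒allPairs : {S : A → A → Set} {xs : List A} → Unique xs →
                  (∀ {x y} → x ∈ xs → y ∈ xs → x ≢ y → S x y) → AllPairs S xs
unique⇒allPairs [] _ = []
unique⇒allPairs (x∉xs ∷ uniq) rel =
  All.tabulate (λ y∈ → rel (here refl) (there y∈) (All.lookup x∉xs y∈)) ∷
  unique⇒allPairs uniq (λ x∈ y∈ → rel (there x∈) (there y∈))

-- Both edges meet `u`, so as list entries they cannot be disjoint and must be equal; the four cases
-- record which coordinate holds `u`.
disjoint⇒functional : ∀ {m} (G : OrderedGraph m) → IsSimple G →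
                      AllPairs VertexDisjoint (edges G) → Functional G
disjoint⇒functional G simple@(_ , irrefl) disj {u} {v} {v′} uv uv′
  with edge∈edges G simple uv | edge∈edges G simple uv′
... | inj₁ e | inj₁ e′ with allPairs-lookup disj e e′
...   | inj₁ refl = refl
...   | inj₂ (inj₁ (d , _)) = contradiction refl d
...   | inj₂ (inj₂ (d , _)) = contradiction refl d
disjoint⇒functional G simple@(_ , irrefl) disj {u} {v} {v′} uv uv′
    | inj₁ e | inj₂ e′ with allPairs-lookup disj e e′
...   | inj₁ refl = refl
...   | inj₂ (inj₁ (_ , d , _)) = contradiction refl d
...   | inj₂ (inj₂ (_ , _ , d , _)) = contradiction refl d
disjoint⇒functional G simple@(_ , irrefl) disj {u} {v} {v′} uv uv′
    | inj₂ e | inj₁ e′ with allPairs-lookup disj e e′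
...   | inj₁ refl = refl
...   | inj₂ (inj₁ (_ , _ , d , _)) = contradiction refl d
...   | inj₂ (inj₂ (_ , d , _)) = contradiction refl d
disjoint⇒functional G simple@(_ , irrefl) disj {u} {v} {v′} uv uv′
    | inj₂ e | inj₂ e′ with allPairs-lookup disj e e′
...   | inj₁ refl = refl
...   | inj₂ (inj₁ (_ , _ , _ , d)) = contradiction refl d
...   | inj₂ (inj₂ (_ , _ , _ , d)) = contradiction refl d

functional⇒disjoint : ∀ {m} (G : OrderedGraph m) → IsSimple G → Functional G →
                      AllPairs VertexDisjoint (edges G)
functional⇒disjoint G (symm , _) func = unique⇒allPairs (edges-unique G) disjoint
  where
  disjoint : ∀ {p q} → p ∈ edges G → q ∈ edges G → p ≢ q → VertexDisjoint p q
  disjoint {i , j} {k , l} p∈ q∈ p≢q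
    with i<j , ij ← edges⁻ G p∈ | k<l , kl ← edges⁻ G q∈ =
      (λ { refl → p≢q (cong (i ,_) (func ij kl)) }) ,
      -- A vertex that is the smaller end of one edge and the larger end of the other would have a
      -- single neighbour both above and below it.
      (λ { refl → Fin.<-asym i<j (subst (Fin._< i) (sym (func ij (symm k i kl))) k<l) }) ,
      (λ { refl → Fin.<-asym i<j (subst (j Fin.<_) (sym (func (symm i j ij) kl)) k<l) }) ,
      (λ { refl → p≢q (cong (_, j) (func (symm i j ij) (symm k j kl))) })

module _ {m} (σ : Fin m → Fin m) (involutive : ∀ i → σ (σ i) ≡ i) where

  private
    σ-injective : ∀ {i j} → σ i ≡ σ j → i ≡ j
    σ-injective {i} {j} eq = trans (sym (involutive i)) (trans (cong σ eq) (involutive j))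

    sort : Fin m × Fin m → Fin m × Fin m
    sort (i , j) with i Fin.<? j
    ... | yes _ = i , j
    ... | no _  = j , i

    sort-< : ∀ {i j} → i Fin.< j → sort (i , j) ≡ (i , j)
    sort-< {i} {j} i<j with i Fin.<? j
    ... | yes _  = refl
    ... | no i≮j = contradiction i<j i≮j

    sort-> : ∀ {i j} → i Fin.< j → sort (j , i) ≡ (i , j)
    sort-> {i} {j} i<j with j Fin.<? i
    ... | yes j<i = contradiction j<i (Fin.<-asym i<j)
    ... | no _    = refl

  restrict-involutive : ∀ G → restrict (restrict G σ) σ ≡ G
  restrict-involutive G = trans
    (Vec.tabulate-cong λ i → trans
      (Vec.tabulate-cong λ j → trans (edge-restrict G σ (σ i) (σ j))
        (cong₂ (λ i j → Vec.lookup (Vec.lookup G i) j) (involutive i) (involutive j)))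
      (Vec.tabulate∘lookup (Vec.lookup G i)))
    (Vec.tabulate∘lookup G)

  restrict-isSimple : ∀ {G} → IsSimple G → IsSimple (restrict G σ)
  restrict-isSimple {G} (symm , irrefl) =
    (λ i j ij → edge-restrict⁺ G σ (symm _ _ (edge-restrict⁻ G σ ij))) ,
    (λ i ii → irrefl _ (edge-restrict⁻ G σ ii))

  private
    -- σ may reverse an edge, while `edges` lists the smaller endpoint first, so pairs are sorted
    -- again after relabelling. One inequality is enough, since σ is its own inverse.
    edges-≤ : ∀ {G} → IsSimple G → length (edges G) ≤ length (edges (restrict G σ))
    edges-≤ {G} simple = ℕ.≤-trans
      (unique-⊆⇒length≤ (edges-unique G) sub)
      (ℕ.≤-reflexive (List.length-map relabel (edges (restrict G σ))))
      where
      relabel : Fin m × Fin m → Fin m × Fin m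
      relabel (i , j) = sort (σ i , σ j)
      relabel-σ : ∀ i j → relabel (σ i , σ j) ≡ sort (i , j)
      relabel-σ i j = cong₂ (λ i j → sort (i , j)) (involutive i) (involutive j)
      sub : edges G ⊆ map relabel (edges (restrict G σ))
      sub {i , j} ij∈ with i<j , ij ← edges⁻ G ij∈
        with edge∈edges (restrict G σ) (restrict-isSimple {G} simple)
               (edge-restrict⁺ G σ (subst₂ (Edge G) (sym (involutive i)) (sym (involutive j)) ij))
      ... | inj₁ e = subst (_∈ _) (trans (relabel-σ i j) (sort-< i<j)) (∈.∈-map⁺ relabel e)
      ... | inj₂ e = subst (_∈ _) (trans (relabel-σ j i) (sort-> i<j)) (∈.∈-map⁺ relabel e)

  edges-restrict : ∀ {G} → IsSimple G → length (edges (restrict G σ)) ≡ length (edges G)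
  edges-restrict {G} simple = ℕ.≤-antisym
    (subst (λ H → length (edges (restrict G σ)) ≤ length (edges H)) (restrict-involutive G)
      (edges-≤ {restrict G σ} (restrict-isSimple {G} simple)))
    (edges-≤ {G} simple)

  restrict-functional : ∀ {G} → Functional G → Functional (restrict G σ)
  restrict-functional {G} func {u} uv uv′ =
    σ-injective (func {σ u} (edge-restrict⁻ G σ uv) (edge-restrict⁻ G σ uv′))

restrict-isMatching : ∀ n (σ : Fin (2 * n) → Fin (2 * n)) → (∀ i → σ (σ i) ≡ i) →
                      ∀ {G} → IsMatching n G → IsMatching n (restrict G σ)
restrict-isMatching n σ inv {G} (simple , size , disj) =
  restrict-isSimple σ inv {G} simple ,
  trans (edges-restrict σ inv {G} simple) size ,
  functional⇒disjoint (restrict G σ) (restrict-isSimple σ inv {G} simple)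
    (restrict-functional σ inv {G} (disjoint⇒functional G simple disj))

matchingCount : ∀ n {P : OrderedGraph (2 * n) → Set} → Decidable P → ℕ
matchingCount n P? = count (λ G → isMatching? n G ×-dec P? G) (graphs (2 * n))

count-matchings : ∀ n {P : OrderedGraph (2 * n) → Set} (P? : Decidable P) →
                  count (P? ∘ graph) (matchings n) ≡ matchingCount n P?
count-matchings n P? = count-mapMaybe (isMatching? n) (λ _ p → record { isMatching = p })
  graph (λ _ _ → refl) P? (graphs (2 * n))

-- Each graph counted on the left is the relabelling of one counted on the right, namely of its own
-- relabelling; as `graphs` has no repetitions, this inclusion bounds the count.
matchingCount-relabel : ∀ n (σ : Fin (2 * n) → Fin (2 * n)) → (∀ i → σ (σ i) ≡ i) →
  {P Q : OrderedGraph (2 * n) → Set} (P? : Decidable P) (Q? : Decidable Q) →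
  (∀ G → P G → Q (restrict G σ)) → matchingCount n P? ≤ matchingCount n Q?
matchingCount-relabel n σ inv P? Q? P⇒Q = ℕ.≤-trans
  (unique-⊆⇒length≤ (Unique.filter⁺ matchingP? (graphs-unique (2 * n))) sub)
  (ℕ.≤-reflexive (List.length-map (λ G → restrict G σ) (filter matchingQ? (graphs (2 * n)))))
  where
  matchingP? = λ G → isMatching? n G ×-dec P? G
  matchingQ? = λ G → isMatching? n G ×-dec Q? G
  sub : filter matchingP? (graphs (2 * n)) ⊆
        map (λ G → restrict G σ) (filter matchingQ? (graphs (2 * n)))
  sub {G} G∈ with mG , pG ← proj₂ (∈.∈-filter⁻ matchingP? {xs = graphs (2 * n)} G∈) =
    subst (_∈ _) (restrict-involutive σ inv G)
      (∈.∈-map⁺ (λ G → restrict G σ) (∈.∈-filter⁺ matchingQ? (graphs-complete (restrict G σ))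
        (restrict-isMatching n σ inv {G} mG , P⇒Q G pG)))

module _ {m} (a b : Fin m) where

  transpose-left : transpose a b a ≡ b
  transpose-left with a Fin.≟ a
  ... | yes _  = refl
  ... | no a≢a = contradiction refl a≢a

  transpose-right : transpose a b b ≡ a
  transpose-right with b Fin.≟ a
  ... | yes b≡a = b≡a
  ... | no _ with b Fin.≟ b
  ...   | yes _  = refl
  ...   | no b≢b = contradiction refl b≢b

  transpose-other : ∀ {k} → k ≢ a → k ≢ b → transpose a b k ≡ k
  transpose-other {k} k≢a k≢b with k Fin.≟ a
  ... | yes k≡a = contradiction k≡a k≢a
  ... | no _ with k Fin.≟ b
  ...   | yes k≡b = contradiction k≡b k≢b
  ...   | no _    = refl

  transpose-involutive : ∀ k → transpose a b (transpose a b k) ≡ k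
  transpose-involutive k = by-cases (k Fin.≟ a) (k Fin.≟ b)
    where
    by-cases : Dec (k ≡ a) → Dec (k ≡ b) → transpose a b (transpose a b k) ≡ k
    by-cases (yes refl) _          = trans (cong (transpose a b) transpose-left) transpose-right
    by-cases (no _)     (yes refl) = trans (cong (transpose a b) transpose-right) transpose-left
    by-cases (no k≢a)   (no k≢b)   = trans (cong (transpose a b) fixed) fixed
      where fixed = transpose-other k≢a k≢b

-- Matchings that contain prescribed pairs

Pairs : ℕ → Set
Pairs m = List (Fin m × Fin m)

Contains : ∀ {m} → Pairs m → OrderedGraph m → Set
Contains F G = All (uncurry (Edge G)) F

contains? : ∀ {m} (F : Pairs m) → Decidable (Contains F)
contains? F G = All.all? (λ (u , v) → edge? G u v) F

endpoints : ∀ {m} → Pairs m → List (Fin m)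
endpoints []            = []
endpoints ((u , v) ∷ F) = u ∷ v ∷ endpoints F

length-endpoints : ∀ {m} (F : Pairs m) → length (endpoints F) ≡ 2 * length F
length-endpoints []      = refl
length-endpoints (_ ∷ F) = trans (cong (λ l → ℕ.suc (ℕ.suc l)) (length-endpoints F)) (sym (ℕ.*-suc 2 (length F)))

Fresh : ∀ {m} → Fin m → Pairs m → Set
Fresh v = All λ (x , y) → v ≢ x × v ≢ y

∉-endpoints⇒fresh : ∀ {m} {v : Fin m} F → v ∉ endpoints F → Fresh v F
∉-endpoints⇒fresh []      _  = []
∉-endpoints⇒fresh (_ ∷ F) v∉ =
  ((λ { refl → v∉ (here refl) }) , (λ { refl → v∉ (there (here refl)) })) ∷
  ∉-endpoints⇒fresh F (v∉ ∘ there ∘ there)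

_∈?_ : ∀ {m} (x : Fin m) xs → Dec (x ∈ xs)
x ∈? xs = Any.any? (x Fin.≟_) xs

containCount : ∀ n → Pairs (2 * n) → ℕ
containCount n F = matchingCount n (contains? F)

-- The transposition of `v` and `v′` fixes `u` and every endpoint in `F`, and moves the partner of
-- `u` from `v` to `v′`.
containCount-swap : ∀ n {u v v′} (F : Pairs (2 * n)) → u ≢ v → u ≢ v′ → Fresh v F → Fresh v′ F →
                    containCount n ((u , v) ∷ F) ≤ containCount n ((u , v′) ∷ F)
containCount-swap n {u} {v} {v′} F u≢v u≢v′ fresh fresh′ =
  matchingCount-relabel n σ (transpose-involutive v v′) (contains? _) (contains? _) moved
  where
  σ = transpose v v′
  moved : ∀ G → Contains ((u , v) ∷ F) G → Contains ((u , v′) ∷ F) (restrict G σ)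
  moved G (uv ∷ F⊆G) =
    edge-restrict⁺ G σ (subst₂ (Edge G)
      (sym (transpose-other v v′ u≢v u≢v′)) (sym (transpose-right v v′)) uv) ∷
    All.zipWith (λ ((v≢x , v≢y) , (v′≢x , v′≢y) , xy) → edge-restrict⁺ G σ (subst₂ (Edge G)
        (sym (transpose-other v v′ (≢-sym v≢x) (≢-sym v′≢x)))
        (sym (transpose-other v v′ (≢-sym v≢y) (≢-sym v′≢y))) xy))
      (fresh , All.zip (fresh′ , F⊆G))

-- A matching gives `u` only one partner, so the events for different v′ exclude each other, and by
-- the swap none is rarer than the one for `v`. Barred as v′ are `u` itself and the 2|F| endpoints,
-- hence the subtracted number.
containCount-step : ∀ n {u v} (F : Pairs (2 * n)) → u ≢ v → Fresh v F →
                    containCount n ((u , v) ∷ F) * (2 * n ∸ suc (2 * length F)) ≤ containCount n F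
containCount-step n {u} {v} F u≢v fresh = begin
  N * (2 * n ∸ suc (2 * length F))                    ≡⟨ ℕ.*-comm N _ ⟩
  (2 * n ∸ suc (2 * length F)) * N                    ≤⟨ ℕ.*-monoˡ-≤ N enough ⟩
  length partners * N
    ≤⟨ packing-bound candidate? (λ G → isMatching? n G ×-dec contains? F G) (graphs (2 * n)) N
         (Unique.filter⁺ partner? (Unique.allFin⁺ (2 * n))) same forget
         (All.tabulate λ v′∈ → swap (proj₂ (∈.∈-filter⁻ partner? {xs = allFin (2 * n)} v′∈))) ⟩
  containCount n F                                    ∎
  where
  open ℕ.≤-Reasoning
  N = containCount n ((u , v) ∷ F)
  used = u ∷ endpoints F
  partner? = λ x → ¬? (x ∈? used)
  partners = filter partner? (allFin (2 * n))
  Candidate : Fin (2 * n) → OrderedGraph (2 * n) → Set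
  Candidate v′ G = IsMatching n G × Contains ((u , v′) ∷ F) G
  candidate? : ∀ v′ → Decidable (Candidate v′)
  candidate? v′ G = isMatching? n G ×-dec contains? ((u , v′) ∷ F) G
  enough : 2 * n ∸ suc (2 * length F) ≤ length partners
  enough = ℕ.≤-trans
    (ℕ.≤-reflexive (sym (cong₂ (λ a b → a ∸ suc b)
      (List.length-tabulate {n = 2 * n} id) (length-endpoints F))))
    (count-∉ _∈?_ (Unique.allFin⁺ (2 * n)) used)
  same : ∀ {i j} G → Candidate i G → Candidate j G → i ≡ j
  same G ((simple , _ , disj) , ui ∷ _) (_ , uj ∷ _) = disjoint⇒functional G simple disj ui uj
  forget : ∀ G → Any (λ i → Candidate i G) partners → IsMatching n G × Contains F G
  forget G any with _ , _ , (mG , _ ∷ F⊆G) ← find any = mG , F⊆G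
  swap : ∀ {v′} → v′ ∉ used → N ≤ containCount n ((u , v′) ∷ F)
  swap v′∉ = containCount-swap n F u≢v (λ { refl → v′∉ (here refl) }) fresh
    (∉-endpoints⇒fresh F (v′∉ ∘ there))

-- For m = 2n and k ≤ n: the numbers of possible partners of k vertices treated one after another,
-- multiplied. Truncated subtraction is harmless there, as all factors are positive.
oddProduct : ℕ → ℕ → ℕ
oddProduct m zero    = 1
oddProduct m (suc k) = oddProduct m k * (m ∸ suc (2 * k))

containCount-bound : ∀ n (F : Pairs (2 * n)) → All (uncurry _≢_) F → AllPairs VertexDisjoint F →
                     containCount n F * oddProduct (2 * n) (length F) ≤ containCount n []
containCount-bound n [] _ _ = ℕ.≤-reflexive (ℕ.*-identityʳ _)
containCount-bound n ((u , v) ∷ F) (u≢v ∷ irrefl) (disj ∷ disjs) = begin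
  N * (o * w)              ≡⟨ cong (N *_) (ℕ.*-comm o w) ⟩
  N * (w * o)              ≡⟨ ℕ.*-assoc N w o ⟨
  N * w * o                ≤⟨ ℕ.*-monoˡ-≤ o (containCount-step n F u≢v
                                (All.map (λ (_ , _ , v≢x , v≢y) → v≢x , v≢y) disj)) ⟩
  containCount n F * o     ≤⟨ containCount-bound n F irrefl disjs ⟩
  containCount n []        ∎
  where
  open ℕ.≤-Reasoning
  N = containCount n ((u , v) ∷ F)
  o = oddProduct (2 * n) (length F)
  w = 2 * n ∸ suc (2 * length F)

-- Embeddings of a fixed matching

-- Pascal's rule: an increasing map either sends 0 to 0, or misses the value 0 and is a shift.
increasingMaps : ∀ l m → List (Fin l → Fin m)
increasingMaps zero    m       = (λ ()) ∷ []
increasingMaps (suc l) zero    = []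
increasingMaps (suc l) (suc m) =
  map (lift 1) (increasingMaps l m) ++ map (suc ∘_) (increasingMaps (suc l) m)

increasingMaps-empty : ∀ {l m} → m < l → length (increasingMaps l m) ≡ 0
increasingMaps-empty {suc l} {zero}  _         = refl
increasingMaps-empty {suc l} {suc m} (s≤s m<l) = trans (List.length-++ (map (lift 1) (increasingMaps l m)))
  (cong₂ _+_ (trans (List.length-map _ (increasingMaps l m)) (increasingMaps-empty m<l))
    (trans (List.length-map _ (increasingMaps (suc l) m)) (increasingMaps-empty (ℕ.m<n⇒m<1+n m<l))))

-- Multiplied by factorials, Pascal's rule becomes (l + 1)(m)ₗ + (m - l)(m)ₗ = (m + 1)(m)ₗ for
-- falling factorials. The case l > m is separate because `m ∸ l` truncates there.
length-increasingMaps : ∀ l m → length (increasingMaps l m) * l ! ≤ m P′ l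
length-increasingMaps zero m = ℕ.≤-refl
length-increasingMaps (suc l) zero = z≤n
length-increasingMaps (suc l) (suc m) with l ℕ.≤? m
... | no l≰m = subst (λ c → c * suc l ! ≤ suc m P′ suc l)
    (sym (increasingMaps-empty {suc l} {suc m} (s≤s (ℕ.≰⇒> l≰m)))) z≤n
... | yes l≤m = begin
  length (map (lift 1) (increasingMaps l m) ++ map (suc ∘_) (increasingMaps (suc l) m)) * suc l !
    ≡⟨ cong (_* suc l !) (trans (List.length-++ (map (lift 1) (increasingMaps l m)))
         (cong₂ _+_ (List.length-map _ (increasingMaps l m)) (List.length-map _ (increasingMaps (suc l) m)))) ⟩
  (a + b) * (suc l * l !)              ≡⟨ distr a b (suc l) (l !) ⟩
  suc l * (a * l !) + b * (suc l * l !)  ≤⟨ ℕ.+-mono-≤ (ℕ.*-monoʳ-≤ (suc l) (length-increasingMaps l m))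
                                            (length-increasingMaps (suc l) m) ⟩
  suc l * (m P′ l) + (m ∸ l) * (m P′ l) ≡⟨ ℕ.*-distribʳ-+ (m P′ l) (suc l) (m ∸ l) ⟨
  suc (l + (m ∸ l)) * (m P′ l)         ≡⟨ cong (λ c → suc c * (m P′ l)) (ℕ.m+[n∸m]≡n l≤m) ⟩
  suc m * (m P′ l)                     ≡⟨ nP′k≡n[n∸1P′k∸1] (suc m) (suc l) ⟨
  suc m P′ suc l                       ∎
  where
  open ℕ.≤-Reasoning
  a = length (increasingMaps l m)
  b = length (increasingMaps (suc l) m)
  distr : ∀ a b s f → (a + b) * (s * f) ≡ s * (a * f) + b * (s * f)
  distr = solve-∀

unsuc : ∀ {l m} (w : Fin l → Fin (suc m)) → (∀ i → 0 < Fin.toℕ (w i)) → ∃ λ w′ → ∀ i → w i ≡ suc (w′ i)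
unsuc w pos = (λ i → proj₁ (below (w i) (pos i))) , λ i → proj₂ (below (w i) (pos i))
  where
  below : ∀ {m} (x : Fin (suc m)) → 0 < Fin.toℕ x → ∃ λ y → x ≡ suc y
  below (suc y) _ = y , refl

-- Functions with equal values need not be provably equal, so the list is complete only up to `≗`,
-- and `embeds-cong` carries embeddings across.
increasingMaps-complete : ∀ {l m} (w : Fin l → Fin m) → StrictlyIncreasing w →
                          Any (w ≗_) (increasingMaps l m)
increasingMaps-complete {zero} w incr = here λ ()
increasingMaps-complete {suc l} {zero} w incr with () ← w zero
increasingMaps-complete {suc l} {suc m} w incr with w zero in w0
... | zero =
  Any.++⁺ˡ (Any.map⁺ (Any.map extend (increasingMaps-complete w′ λ {i} {j} i<j →
    ℕ.≤-pred (subst₂ Fin._<_ (w≡ i) (w≡ j) (incr (s≤s i<j))))))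
  where
  tail = unsuc (w ∘ suc) (λ i → subst (Fin._< w (suc i)) w0 (incr (s≤s z≤n)))
  w′ = proj₁ tail
  w≡ = proj₂ tail
  extend : ∀ {w″} → w′ ≗ w″ → w ≗ lift 1 w″
  extend eq zero    = w0
  extend eq (suc i) = trans (w≡ i) (cong suc (eq i))
... | suc x =
  Any.++⁺ʳ (map (lift 1) (increasingMaps l m)) (Any.map⁺ (Any.map
    (λ eq i → trans (w≡ i) (cong suc (eq i)))
    (increasingMaps-complete w′ λ {i} {j} i<j →
      ℕ.≤-pred (subst₂ Fin._<_ (w≡ i) (w≡ j) (incr i<j)))))
  where
  pos : ∀ i → 0 < Fin.toℕ (w i)
  pos zero    = subst (λ x → 0 < Fin.toℕ x) (sym w0) (s≤s z≤n)
  pos (suc i) = ℕ.<-trans (pos zero) (incr (s≤s z≤n))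
  w′ = proj₁ (unsuc w pos)
  w≡ = proj₂ (unsuc w pos)

strictlyIncreasing? : ∀ {l m} (w : Fin l → Fin m) → Dec (StrictlyIncreasing w)
strictlyIncreasing? w = map′ (λ h {i} {j} → h i j) (λ h i j → h {i} {j})
  (Fin.all? λ i → Fin.all? λ j → (i Fin.<? j) →-dec (w i Fin.<? w j))

module _ {k} (H : OrderedMatching k) (n : ℕ) where

  Embeds : OrderedGraph (2 * n) → (Fin (2 * k) → Fin (2 * n)) → Set
  Embeds G w = StrictlyIncreasing w × OrderIsomorphic (graph H) (restrict G w)

  embeds? : ∀ G w → Dec (Embeds G w)
  embeds? G w =
    strictlyIncreasing? w ×-dec
    map′ (λ h {i} {j} i<j → mk⇔ (proj₁ (h i j i<j)) (proj₂ (h i j i<j)))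
      (λ h i j i<j → Equivalence.to (h {i} {j} i<j) , Equivalence.from (h {i} {j} i<j))
      (Fin.all? λ i → Fin.all? λ j → (i Fin.<? j) →-dec
        ((edge? (graph H) i j →-dec edge? (restrict G w) i j) ×-dec
         (edge? (restrict G w) i j →-dec edge? (graph H) i j)))

  embeds-cong : ∀ {G w w′} → w ≗ w′ → Embeds G w → Embeds G w′
  embeds-cong {G} {w} {w′} eq (incr , iso) =
    (λ {i} {j} i<j → subst₂ Fin._<_ (eq i) (eq j) (incr i<j)) ,
    (λ {i} {j} i<j → subst (λ b → Bool.T (Vec.lookup (Vec.lookup (graph H) i) j) ⇔ Bool.T b)
      (trans (edge-restrict G w i j) (trans
        (cong₂ (λ x y → Vec.lookup (Vec.lookup G x) y) (eq i) (eq j))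
        (sym (edge-restrict G w′ i j)))) (iso i<j))

  embedding⇒any : ∀ {G} → ∃ (Embeds G) → Any (Embeds G) (increasingMaps (2 * k) (2 * n))
  embedding⇒any {G} (w , emb) =
    Any.map (λ eq → embeds-cong {G} eq emb) (increasingMaps-complete w (proj₁ emb))

  embedding? : ∀ G → Dec (∃ (Embeds G))
  embedding? G = map′ (λ any → let w , _ , emb = find any in w , emb) (embedding⇒any {G})
    (Any.any? (embeds? G) (increasingMaps (2 * k) (2 * n)))

strictlyIncreasing⇒injective : ∀ {l m} (w : Fin l → Fin m) → StrictlyIncreasing w →
                               ∀ {i j} → w i ≡ w j → i ≡ j
strictlyIncreasing⇒injective w incr {i} {j} eq with Fin.<-cmp i j
... | tri< i<j _ _ = contradiction eq (Fin.<⇒≢ (incr i<j))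
... | tri≈ _ i≡j _ = i≡j
... | tri> _ _ j<i = contradiction (sym eq) (Fin.<⇒≢ (incr j<i))

oddProduct>0 : ∀ n k → k ≤ n → 0 < oddProduct (2 * n) k
oddProduct>0 n zero    _   = s≤s z≤n
oddProduct>0 n (suc k) k<n = ℕ.*-mono-< (oddProduct>0 n k (ℕ.<⇒≤ k<n)) (ℕ.m<n⇒0<n∸m (begin
  suc (suc (2 * k))  ≡⟨ ℕ.*-suc 2 k ⟨
  2 * suc k          ≤⟨ ℕ.*-monoʳ-≤ 2 k<n ⟩
  2 * n              ∎))
  where open ℕ.≤-Reasoning

-- Of the 2k factors m, m - 1, ..., every second one, from m - 1 on, goes into `oddProduct`, and
-- each of the remaining k is at most m.
P′-≤-oddProduct : ∀ m k → m P′ (2 * k) ≤ m ^ k * oddProduct m k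
P′-≤-oddProduct m zero    = ℕ.≤-refl
P′-≤-oddProduct m (suc k) = begin
  m P′ (2 * suc k)                                  ≡⟨ cong (m P′_) (ℕ.*-suc 2 k) ⟩
  w * ((m ∸ 2 * k) * (m P′ (2 * k)))                ≤⟨ ℕ.*-monoʳ-≤ w (ℕ.*-mono-≤ (ℕ.m∸n≤m m (2 * k)) (P′-≤-oddProduct m k)) ⟩
  w * (m * (m ^ k * oddProduct m k))                ≡⟨ rearrange w m (m ^ k) (oddProduct m k) ⟩
  m * m ^ k * (oddProduct m k * w)                  ∎
  where
  open ℕ.≤-Reasoning
  w = m ∸ suc (2 * k)
  rearrange : ∀ w m x o → w * (m * (x * o)) ≡ m * x * (o * w)
  rearrange = solve-∀

containCount-[] : ∀ n → containCount n [] ≡ length (matchings n)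
containCount-[] n = trans (sym (count-matchings n (contains? [])))
  (cong length (List.filter-all (λ RM → contains? [] (graph RM)) (All.universal (λ _ → []) (matchings n))))

module _ {k} (n : ℕ) (H : OrderedMatching k) where

  private
    image : (Fin (2 * k) → Fin (2 * n)) → Pairs (2 * n)
    image w = map (λ (i , j) → w i , w j) (edges (graph H))

    embeds⇒contains : ∀ G w → Embeds H n G w → Contains (image w) G
    embeds⇒contains G w (_ , iso) = All.map⁺ (All.tabulate λ {(i , j)} ij∈ →
      let i<j , ij = edges⁻ (graph H) ij∈ in edge-restrict⁻ G w (Equivalence.to (iso {i} {j} i<j) ij))

    length-image : ∀ w → length (image w) ≡ k
    length-image w = trans
      (List.length-map (λ (i , j) → w i , w j) (edges (graph H))) (proj₁ (proj₂ (isMatching H)))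

    image-irreflexive : ∀ w → StrictlyIncreasing w → All (uncurry _≢_) (image w)
    image-irreflexive w incr =
      All.map⁺ (All.tabulate λ ij∈ → Fin.<⇒≢ (incr (proj₁ (edges⁻ (graph H) ij∈))))

    image-disjoint : ∀ w → StrictlyIncreasing w → AllPairs VertexDisjoint (image w)
    image-disjoint w incr = AllPairs.map⁺ (AllPairs.map
      (λ (i≢k , i≢l , j≢k , j≢l) → i≢k ∘ inj , i≢l ∘ inj , j≢k ∘ inj , j≢l ∘ inj)
      (proj₂ (proj₂ (isMatching H))))
      where
      inj : ∀ {i j} → w i ≡ w j → i ≡ j
      inj = strictlyIncreasing⇒injective w incr

    embeds≤contains : ∀ w → matchingCount n (λ G → embeds? H n G w) ≤ containCount n (image w)
    embeds≤contains w = count-mono (λ G → isMatching? n G ×-dec embeds? H n G w)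
      (λ G → isMatching? n G ×-dec contains? (image w) G)
      (λ G (mG , emb) → mG , embeds⇒contains G w emb) (graphs (2 * n))

    fixedCount : ∀ w → StrictlyIncreasing w →
                 matchingCount n (λ G → embeds? H n G w) * oddProduct (2 * n) k ≤ length (matchings n)
    fixedCount w incr = begin
      matchingCount n (λ G → embeds? H n G w) * oddProduct (2 * n) k
        ≤⟨ ℕ.*-monoˡ-≤ (oddProduct (2 * n) k) (embeds≤contains w) ⟩
      containCount n (image w) * oddProduct (2 * n) k
        ≡⟨ cong (λ l → containCount n (image w) * oddProduct (2 * n) l) (length-image w) ⟨
      containCount n (image w) * oddProduct (2 * n) (length (image w))
        ≤⟨ containCount-bound n (image w) (image-irreflexive w incr) (image-disjoint w incr) ⟩
      containCount n []
        ≡⟨ containCount-[] n ⟩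
      length (matchings n) ∎
      where open ℕ.≤-Reasoning

    -- For `increasingMaps` only completeness is established, so the bound has to cover every `w`; a
    -- map that is not increasing is never an embedding.
    mapCount : ∀ w → matchingCount n (λ G → embeds? H n G w) * oddProduct (2 * n) k ≤ length (matchings n)
    mapCount w = by-cases (strictlyIncreasing? w)
      where
      by-cases : Dec (StrictlyIncreasing w) →
                 matchingCount n (λ G → embeds? H n G w) * oddProduct (2 * n) k ≤ length (matchings n)
      by-cases (yes incr) = fixedCount w incr
      by-cases (no ¬incr) = subst (λ Gs → length Gs * oddProduct (2 * n) k ≤ length (matchings n))
        (sym (List.filter-none (λ G → isMatching? n G ×-dec embeds? H n G w)
          (All.universal (λ _ (_ , incr , _) → ¬incr incr) (graphs (2 * n))))) z≤n

  -- The union bound costs a falling factorial over (2k)!; the `oddProduct` part of it cancels,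
  -- being positive by `k ≤ n`.
  embeddingCount-bound : k ≤ n →
    matchingCount n (embedding? H n) * (2 * k) ! ≤ (2 * n) ^ k * length (matchings n)
  embeddingCount-bound k≤n = ℕ.*-cancelʳ-≤ _ _ o {{ℕ.>-nonZero (oddProduct>0 n k k≤n)}} (begin
    c * (2 * k) ! * o                    ≡⟨ swap c ((2 * k) !) o ⟩
    c * o * (2 * k) !                    ≤⟨ ℕ.*-monoˡ-≤ ((2 * k) !) union ⟩
    l * Ω * (2 * k) !                    ≡⟨ swap l Ω ((2 * k) !) ⟩
    l * (2 * k) ! * Ω                    ≤⟨ ℕ.*-monoˡ-≤ Ω (ℕ.≤-trans (length-increasingMaps (2 * k) (2 * n))
                                              (P′-≤-oddProduct (2 * n) k)) ⟩
    (2 * n) ^ k * o * Ω                  ≡⟨ swap ((2 * n) ^ k) o Ω ⟩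
    (2 * n) ^ k * Ω * o                  ∎)
    where
    open ℕ.≤-Reasoning
    c = matchingCount n (embedding? H n)
    o = oddProduct (2 * n) k
    Ω = length (matchings n)
    maps = increasingMaps (2 * k) (2 * n)
    l = length maps
    swap : ∀ a b c → a * b * c ≡ a * c * b
    swap = solve-∀
    union : c * o ≤ l * Ω
    union = union-bound (λ w G → isMatching? n G ×-dec embeds? H n G w)
      (λ G → isMatching? n G ×-dec embedding? H n G) (graphs (2 * n)) maps o Ω
      (λ G (mG , emb) → Any.map (λ e → mG , e) (embedding⇒any H n {G} emb))
      (All.universal mapCount maps)

-- Exponential and factorial estimates

^-distribʳ-* : ∀ k a b → (a * b) ^ k ≡ a ^ k * b ^ k
^-distribʳ-* zero    a b = refl
^-distribʳ-* (suc k) a b = trans (cong (a * b *_) (^-distribʳ-* k a b)) (rearrange a b (a ^ k) (b ^ k))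
  where
  rearrange : ∀ a b x y → a * b * (x * y) ≡ a * x * (b * y)
  rearrange = solve-∀

-- m! Σ_{i ≤ m} 1/i!
scaledExp : ℕ → ℕ
scaledExp zero    = 1
scaledExp (suc m) = suc m * scaledExp m + 1

-- m! jᵐ Σ_{l ≤ m} (i/j)ˡ/l!
private
  scaledExpAt : ℕ → ℕ → ℕ → ℕ
  scaledExpAt j zero    i = 1
  scaledExpAt j (suc m) i = suc m * (j * scaledExpAt j m i) + i ^ suc m

  -- The first two terms of the binomial expansion.
  binomial-≤ : ∀ i m → i ^ suc m + suc m * i ^ m ≤ suc i ^ suc m
  binomial-≤ i zero    = ℕ.≤-reflexive (ℕ.+-comm (i * 1) 1)
  binomial-≤ i (suc m) = begin
    i * i ^ suc m + suc (suc m) * i ^ suc m                 ≤⟨ ℕ.m≤m+n _ (suc m * i ^ m) ⟩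
    i * i ^ suc m + suc (suc m) * i ^ suc m + suc m * i ^ m ≡⟨ expand i (i ^ m) m ⟩
    suc i * (i ^ suc m + suc m * i ^ m)                     ≤⟨ ℕ.*-monoʳ-≤ (suc i) (binomial-≤ i m) ⟩
    suc i * suc i ^ suc m                                   ∎
    where
    open ℕ.≤-Reasoning
    expand : ∀ i x m → i * (i * x) + suc (suc m) * (i * x) + suc m * x ≡ suc i * (i * x + suc m * x)
    expand = solve-∀

  -- With s_m(x) = Σ_{l ≤ m} xˡ/l! and x = i/j, for j > 0, this reads s_{m+1}(x) + s_m(x)/j ≤
  -- s_{m+1}(x + 1/j): the tangent inequality, s_m being the derivative of s_{m+1}. In the induction
  -- `binomial-≤` handles the top term.
  scaledExpAt-step : ∀ j m i →
    scaledExpAt j (suc m) i + suc m * scaledExpAt j m i ≤ scaledExpAt j (suc m) (suc i)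
  scaledExpAt-step j zero    i = ℕ.≤-reflexive (base j i)
    where
    base : ∀ j i → 1 * (j * 1) + i * 1 + 1 * 1 ≡ 1 * (j * 1) + suc i * 1
    base = solve-∀
  scaledExpAt-step j (suc m) i = begin
    scaledExpAt j (2 + m) i + (2 + m) * a₁
      ≡⟨ regroup m j a₁ (scaledExpAt j m i) (i ^ suc m) i ⟩
    (2 + m) * (j * (a₁ + suc m * scaledExpAt j m i)) + (i ^ (2 + m) + (2 + m) * i ^ suc m)
      ≤⟨ ℕ.+-mono-≤ (ℕ.*-monoʳ-≤ (2 + m) (ℕ.*-monoʳ-≤ j (scaledExpAt-step j m i))) (binomial-≤ i (suc m)) ⟩
    scaledExpAt j (2 + m) (suc i) ∎
    where
    open ℕ.≤-Reasoning
    a₁ = scaledExpAt j (suc m) i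
    regroup : ∀ m j a b x i → let a = suc m * (j * b) + x in
      suc (suc m) * (j * a) + i * x + suc (suc m) * a ≡
      suc (suc m) * (j * (a + suc m * b)) + (i * x + suc (suc m) * x)
    regroup = solve-∀

  -- Generalises (1 + 1/j)ʲ ≤ Σ_{l ≤ j} 1/l! so that degree and argument of the truncated
  -- exponential rise together: by the tangent inequality, a factor 1 + 1/j is absorbed when the
  -- degree grows by 1 and the argument by 1/j. The case of interest is i = j.
  power≤scaledExpAt : ∀ j i → suc j ^ i * i ! ≤ scaledExpAt j i i
  power≤scaledExpAt j zero    = ℕ.≤-refl
  power≤scaledExpAt j (suc i) = begin
    suc j * suc j ^ i * (suc i * i !)            ≡⟨ rearrange j i (suc j ^ i) (i !) ⟩
    suc j * suc i * (suc j ^ i * i !)            ≤⟨ ℕ.*-monoʳ-≤ (suc j * suc i) (power≤scaledExpAt j i) ⟩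
    suc j * suc i * a                            ≡⟨ split j i a ⟩
    suc i * (j * a) + suc i * a                  ≤⟨ ℕ.+-monoˡ-≤ (suc i * a) (ℕ.m≤m+n (suc i * (j * a)) (i ^ suc i)) ⟩
    scaledExpAt j (suc i) i + suc i * a          ≤⟨ scaledExpAt-step j i i ⟩
    scaledExpAt j (suc i) (suc i)                ∎
    where
    open ℕ.≤-Reasoning
    a = scaledExpAt j i i
    rearrange : ∀ j i x y → suc j * x * (suc i * y) ≡ suc j * suc i * (x * y)
    rearrange = solve-∀
    split : ∀ j i a → suc j * suc i * a ≡ suc i * (j * a) + suc i * a
    split = solve-∀

  scaledExpAt-diagonal : ∀ j m → scaledExpAt j m j ≡ j ^ m * scaledExp m
  scaledExpAt-diagonal j zero    = refl
  scaledExpAt-diagonal j (suc m) = trans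
    (cong (λ a → suc m * (j * a) + j ^ suc m) (scaledExpAt-diagonal j m))
    (collect m j (j ^ m) (scaledExp m))
    where
    collect : ∀ m j x e → suc m * (j * (x * e)) + j * x ≡ j * x * (suc m * e + 1)
    collect = solve-∀

-- (1 + 1/j)ʲ ≤ Σ_{i ≤ j} 1/i!
euler-bound : ∀ j → suc j ^ j * j ! ≤ j ^ j * scaledExp j
euler-bound j = subst (suc j ^ j * j ! ≤_) (scaledExpAt-diagonal j j) (power≤scaledExpAt j j)

scaledExp-mono : ∀ {m n} → m ℕ.≤′ n → scaledExp m * n ! ≤ scaledExp n * m !
scaledExp-mono ℕ.≤′-refl = ℕ.≤-refl
scaledExp-mono {m} {suc n} (ℕ.≤′-step m≤n) = begin
  scaledExp m * (suc n * n !)          ≡⟨ rearrange (scaledExp m) (suc n) (n !) ⟩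
  suc n * (scaledExp m * n !)          ≤⟨ ℕ.*-monoʳ-≤ (suc n) (scaledExp-mono m≤n) ⟩
  suc n * (scaledExp n * m !)          ≡⟨ ℕ.*-assoc (suc n) (scaledExp n) (m !) ⟨
  suc n * scaledExp n * m !            ≤⟨ ℕ.*-monoˡ-≤ (m !) (ℕ.m≤m+n (suc n * scaledExp n) 1) ⟩
  scaledExp (suc n) * m !              ∎
  where
  open ℕ.≤-Reasoning
  rearrange : ∀ a b c → a * (b * c) ≡ b * (a * c)
  rearrange = solve-∀

!≤scaledExp : ∀ n → n ! ≤ scaledExp n
!≤scaledExp n = subst₂ _≤_ (ℕ.*-identityˡ (n !)) (ℕ.*-identityʳ (scaledExp n))
  (scaledExp-mono (ℕ.≤⇒≤′ (z≤n {n})))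

-- A single truncation `n` must serve all `j` in the induction for the factorial.
euler-bound′ : ∀ {j n} → j ≤ n → suc j ^ j * n ! ≤ j ^ j * scaledExp n
euler-bound′ {j} {n} j≤n = ℕ.*-cancelʳ-≤ _ _ (j !) {{j ℕ.!≢0}} (begin
  suc j ^ j * n ! * j !                ≡⟨ swap (suc j ^ j) (n !) (j !) ⟩
  suc j ^ j * j ! * n !                ≤⟨ ℕ.*-monoˡ-≤ (n !) (euler-bound j) ⟩
  j ^ j * scaledExp j * n !            ≡⟨ ℕ.*-assoc (j ^ j) (scaledExp j) (n !) ⟩
  j ^ j * (scaledExp j * n !)          ≤⟨ ℕ.*-monoʳ-≤ (j ^ j) (scaledExp-mono (ℕ.≤⇒≤′ j≤n)) ⟩
  j ^ j * (scaledExp n * j !)          ≡⟨ ℕ.*-assoc (j ^ j) (scaledExp n) (j !) ⟨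
  j ^ j * scaledExp n * j !            ∎)
  where
  open ℕ.≤-Reasoning
  swap : ∀ a b c → a * b * c ≡ a * c * b
  swap = solve-∀

-- j! ≥ (j/q)ʲ for q = Σ_{i ≤ n} 1/i! and j ≤ n
factorial-lower : ∀ {n} j → j ≤ n → (j * n !) ^ j ≤ j ! * scaledExp n ^ j
factorial-lower zero    _ = ℕ.≤-refl
factorial-lower {n} (suc j) j<n = begin
  suc j * q * (suc j * q) ^ j          ≡⟨ cong (suc j * q *_) (^-distribʳ-* j (suc j) q) ⟩
  suc j * q * (suc j ^ j * q ^ j)      ≡⟨ rearrange₁ (suc j) q (suc j ^ j) (q ^ j) ⟩
  -- (1 + 1/j)ʲ ≤ p/q turns (j + 1)ʲ into jʲ, to which the induction hypothesis applies.
  suc j * (suc j ^ j * q) * q ^ j      ≤⟨ ℕ.*-monoˡ-≤ (q ^ j) (ℕ.*-monoʳ-≤ (suc j) (euler-bound′ (ℕ.<⇒≤ j<n))) ⟩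
  suc j * (j ^ j * p) * q ^ j          ≡⟨ rearrange₂ (suc j) (j ^ j) p (q ^ j) ⟩
  suc j * p * (j ^ j * q ^ j)          ≡⟨ cong (suc j * p *_) (^-distribʳ-* j j q) ⟨
  suc j * p * (j * q) ^ j              ≤⟨ ℕ.*-monoʳ-≤ (suc j * p) (factorial-lower j (ℕ.<⇒≤ j<n)) ⟩
  suc j * p * (j ! * p ^ j)            ≡⟨ rearrange₃ (suc j) p (j !) (p ^ j) ⟩
  suc j * j ! * (p * p ^ j)            ∎
  where
  open ℕ.≤-Reasoning
  q = n !
  p = scaledExp n
  rearrange₁ : ∀ s q x y → s * q * (x * y) ≡ s * (x * q) * y
  rearrange₁ = solve-∀
  rearrange₂ : ∀ s x p y → s * (x * p) * y ≡ s * p * (x * y)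
  rearrange₂ = solve-∀
  rearrange₃ : ∀ s p f y → s * p * (f * y) ≡ s * f * (p * y)
  rearrange₃ = solve-∀

-- k > (1 + 1/T) (P/Q) √(n/2)
Exceeds : (n T P Q k : ℕ) → Set
Exceeds n T P Q k = 2 * n * (suc T * P) ^ 2 < (2 * k * Q * T) ^ 2

-- The two bounds give c/Ω ≤ (2n)ᵏ/(2k)! ≤ (2nP²/(2kQ)²)ᵏ, and `Exceeds` puts the base of the last
-- power below (T/(T + 1))².
exceeds⇒decay : ∀ n k T P Q c Ω .{{_ : NonZero k}} .{{_ : NonZero Q}} →
  (2 * k * Q) ^ (2 * k) ≤ (2 * k) ! * P ^ (2 * k) →
  c * (2 * k) ! ≤ (2 * n) ^ k * Ω →
  Exceeds n T P Q k →
  c * suc T ^ (2 * k) ≤ T ^ (2 * k) * Ω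
exceeds⇒decay n k T P Q c Ω stirling moment exceeds =
  ℕ.*-cancelʳ-≤ _ _ (MQ ^ M) {{ℕ.m^n≢0 MQ M {{ℕ.m*n≢0 M Q {{ℕ.m*n≢0 2 k}}}}}} (begin
    c * suc T ^ M * MQ ^ M                 ≤⟨ ℕ.*-monoʳ-≤ (c * suc T ^ M) stirling ⟩
    c * suc T ^ M * (M ! * P ^ M)          ≡⟨ rearrange c (suc T ^ M) (M !) (P ^ M) ⟩
    c * M ! * (suc T ^ M * P ^ M)          ≤⟨ ℕ.*-monoˡ-≤ (suc T ^ M * P ^ M) moment ⟩
    (2 * n) ^ k * Ω * (suc T ^ M * P ^ M)
      ≡⟨ cong ((2 * n) ^ k * Ω *_) (trans (ℕ.^-*-assoc (suc T * P) 2 k) (^-distribʳ-* M (suc T) P)) ⟨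
    (2 * n) ^ k * Ω * ((suc T * P) ^ 2) ^ k ≡⟨ swap ((2 * n) ^ k) Ω (((suc T * P) ^ 2) ^ k) ⟩
    (2 * n) ^ k * ((suc T * P) ^ 2) ^ k * Ω ≡⟨ cong (_* Ω) (^-distribʳ-* k (2 * n) ((suc T * P) ^ 2)) ⟨
    (2 * n * (suc T * P) ^ 2) ^ k * Ω      ≤⟨ ℕ.*-monoˡ-≤ Ω (ℕ.^-monoˡ-≤ k (ℕ.<⇒≤ exceeds)) ⟩
    ((MQ * T) ^ 2) ^ k * Ω
      ≡⟨ cong (_* Ω) (trans (ℕ.^-*-assoc (MQ * T) 2 k) (^-distribʳ-* M MQ T)) ⟩
    MQ ^ M * T ^ M * Ω                     ≡⟨ rotate (MQ ^ M) (T ^ M) Ω ⟩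
    T ^ M * Ω * MQ ^ M                     ∎)
  where
  open ℕ.≤-Reasoning
  M = 2 * k
  MQ = M * Q
  rearrange : ∀ c t f p → c * t * (f * p) ≡ c * f * (t * p)
  rearrange = solve-∀
  swap : ∀ a b c → a * b * c ≡ a * c * b
  swap = solve-∀
  rotate : ∀ a b c → a * b * c ≡ b * c * a
  rotate = solve-∀

-- The factor (1 + 1/T) P/Q is at least 1, so k > √(n/2). This provides the many factors that the
-- decay needs.
exceeds⇒large : ∀ n k T P Q → Q ≤ P → Exceeds n T P Q k → n < (2 * k) ^ 2
exceeds⇒large n k T P Q Q≤P exceeds = ℕ.*-cancelʳ-< ((suc T * P) ^ 2) _ _ (begin-strict
  n * (suc T * P) ^ 2           ≤⟨ ℕ.*-monoˡ-≤ ((suc T * P) ^ 2) (ℕ.m≤m+n n (1 * n)) ⟩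
  2 * n * (suc T * P) ^ 2       <⟨ exceeds ⟩
  (2 * k * Q * T) ^ 2           ≡⟨ cong (_^ 2) (rearrange (2 * k) Q T) ⟩
  (2 * k * (T * Q)) ^ 2         ≡⟨ ^-distribʳ-* 2 (2 * k) (T * Q) ⟩
  (2 * k) ^ 2 * (T * Q) ^ 2     ≤⟨ ℕ.*-monoʳ-≤ ((2 * k) ^ 2) (ℕ.^-monoˡ-≤ 2 (ℕ.*-mono-≤ (ℕ.n≤1+n T) Q≤P)) ⟩
  (2 * k) ^ 2 * (suc T * P) ^ 2 ∎)
  where
  open ℕ.≤-Reasoning
  rearrange : ∀ a q t → a * q * t ≡ a * (t * q)
  rearrange = solve-∀

n≤2^n : ∀ n → n ≤ 2 ^ n
n≤2^n zero    = z≤n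
n≤2^n (suc n) = begin
  1 + n              ≤⟨ ℕ.+-mono-≤ (ℕ.m^n>0 2 n) (n≤2^n n) ⟩
  2 ^ n + 2 ^ n      ≡⟨ cong (2 ^ n +_) (ℕ.+-identityʳ (2 ^ n)) ⟨
  2 * 2 ^ n          ∎
  where open ℕ.≤-Reasoning

-- Bernoulli's inequality: (1 + 1/T)ᵀ ≥ 1 + T/T.
doubling : ∀ T .{{_ : NonZero T}} → 2 * T ^ T ≤ suc T ^ T
doubling T@(suc T-1) = ℕ.≤-trans (ℕ.≤-reflexive (split T-1 (T ^ T-1))) (binomial-≤ T T-1)
  where
  split : ∀ t x → 2 * (suc t * x) ≡ suc t * x + suc t * x
  split = solve-∀

-- (1 + 1/T)ᴹ ≥ 2^(dT) = (2ᵀ)ᵈ ≥ Tᵈ; `r` collects the factors beyond the first T · dT, each bounded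
-- below by 1.
exponential-growth : ∀ T .{{_ : NonZero T}} d {M} → T * (d * T) ≤ M → T ^ M * T ^ d ≤ suc T ^ M
exponential-growth T d {M} le = begin
  T ^ M * T ^ d                             ≡⟨ cong (λ m → T ^ m * T ^ d) M≡ ⟨
  T ^ (T * (d * T) + r) * T ^ d             ≡⟨ cong (_* T ^ d) (split T) ⟩
  (T ^ T) ^ (d * T) * T ^ r * T ^ d         ≤⟨ ℕ.*-monoʳ-≤ ((T ^ T) ^ (d * T) * T ^ r) (ℕ.^-monoˡ-≤ d (n≤2^n T)) ⟩
  (T ^ T) ^ (d * T) * T ^ r * (2 ^ T) ^ d   ≡⟨ cong ((T ^ T) ^ (d * T) * T ^ r *_)
                                                 (trans (ℕ.^-*-assoc 2 T d) (cong (2 ^_) (ℕ.*-comm T d))) ⟩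
  (T ^ T) ^ (d * T) * T ^ r * 2 ^ (d * T)   ≡⟨ rearrange ((T ^ T) ^ (d * T)) (T ^ r) (2 ^ (d * T)) ⟩
  2 ^ (d * T) * (T ^ T) ^ (d * T) * T ^ r   ≡⟨ cong (_* T ^ r) (^-distribʳ-* (d * T) 2 (T ^ T)) ⟨
  (2 * T ^ T) ^ (d * T) * T ^ r             ≤⟨ ℕ.*-mono-≤ (ℕ.^-monoˡ-≤ (d * T) (doubling T))
                                                 (ℕ.^-monoˡ-≤ r (ℕ.n≤1+n T)) ⟩
  (suc T ^ T) ^ (d * T) * suc T ^ r         ≡⟨ split (suc T) ⟨
  suc T ^ (T * (d * T) + r)                 ≡⟨ cong (suc T ^_) M≡ ⟩
  suc T ^ M                                 ∎
  where
  open ℕ.≤-Reasoning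
  r = M ∸ T * (d * T)
  M≡ : T * (d * T) + r ≡ M
  M≡ = ℕ.m+[n∸m]≡n le
  split : ∀ b → b ^ (T * (d * T) + r) ≡ (b ^ T) ^ (d * T) * b ^ r
  split b = trans (ℕ.^-distribˡ-+-* b (T * (d * T)) r) (cong (_* b ^ r) (sym (ℕ.^-*-assoc b T (d * T))))
  rearrange : ∀ a b c → a * b * c ≡ c * a * b
  rearrange = solve-∀

-- The choice of the scale T

⌊⁸√_⌋ : ℕ → ℕ
⌊⁸√ n ⌋ = isqrt (isqrt (isqrt n))

isqrt-≥ : ∀ {c n} → c * c ≤ n → c ≤ isqrt n
isqrt-≥ {c} {n} le = ℕ.≤-pred (square-cancel-< (ℕ.≤-<-trans le (isqrt-upper n)))

eighth-power : ∀ c → c * c * (c * c) * (c * c * (c * c)) ≡ c ^ 8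
eighth-power = expanded
  where
  expanded : ∀ c → c * c * (c * c) * (c * c * (c * c)) ≡ c * (c * (c * (c * (c * (c * (c * (c * 1)))))))
  expanded = solve-∀

⌊⁸√⌋-≥ : ∀ {c n} → c ^ 8 ≤ n → c ≤ ⌊⁸√ n ⌋
⌊⁸√⌋-≥ {c} {n} le = isqrt-≥ (isqrt-≥ (isqrt-≥ (ℕ.≤-trans (ℕ.≤-reflexive (eighth-power c)) le)))

⌊⁸√⌋-unbounded : ∀ c → ∃ λ N → ∀ n → N ≤ n → c ≤ ⌊⁸√ n ⌋
⌊⁸√⌋-unbounded c = c ^ 8 , λ _ → ⌊⁸√⌋-≥

⌊⁸√⌋-upper : ∀ n → n < suc ⌊⁸√ n ⌋ ^ 8
⌊⁸√⌋-upper n = begin-strict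
  n                                          <⟨ isqrt-upper n ⟩
  suc (isqrt n) * suc (isqrt n)              ≤⟨ square (isqrt-upper (isqrt n)) ⟩
  b * b * (b * b)                            ≤⟨ square (square (isqrt-upper (isqrt (isqrt n)))) ⟩
  c * c * (c * c) * (c * c * (c * c))        ≡⟨ eighth-power c ⟩
  c ^ 8                                      ∎
  where
  open ℕ.≤-Reasoning
  b = suc (isqrt (isqrt n))
  c = suc ⌊⁸√ n ⌋
  square : ∀ {x y} → x ≤ y → x * x ≤ y * y
  square le = ℕ.*-mono-≤ le le

-- As t⁴ ≤ √n < m, it is enough that 9(t + 1)² ≤ t⁴, that is 3(t + 1) ≤ t²; the least such natural
-- number is 4. The 9 is the exponent asked of `exponential-growth`.
⌊⁸√⌋-square-bound : ∀ {n m} → 4 ≤ ⌊⁸√ n ⌋ → n < m ^ 2 → suc ⌊⁸√ n ⌋ * (9 * suc ⌊⁸√ n ⌋) ≤ m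
⌊⁸√⌋-square-bound {n} {m} 4≤t n<m² = begin
  suc t * (9 * suc t)              ≡⟨ nine (suc t) ⟩
  3 * suc t * (3 * suc t)          ≤⟨ ℕ.*-mono-≤ linear linear ⟩
  t * t * (t * t)                  ≤⟨ ℕ.*-mono-≤ (isqrt-lower s₂) (isqrt-lower s₂) ⟩
  s₂ * s₂                          ≤⟨ isqrt-lower s₁ ⟩
  s₁                               ≤⟨ ℕ.<⇒≤ (square-cancel-< (ℕ.≤-<-trans (isqrt-lower n)
                                        (subst (n <_) (cong (m *_) (ℕ.*-identityʳ m)) n<m²))) ⟩
  m                                ∎
  where
  open ℕ.≤-Reasoning
  t = ⌊⁸√ n ⌋
  s₁ = isqrt n
  s₂ = isqrt s₁
  nine : ∀ x → x * (9 * x) ≡ 3 * x * (3 * x)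
  nine = solve-∀
  linear : 3 * suc t ≤ t * t
  linear = begin
    3 * suc t      ≡⟨ ℕ.*-suc 3 t ⟩
    3 + 3 * t      ≤⟨ ℕ.+-monoˡ-≤ (3 * t) (ℕ.≤-trans (ℕ.n≤1+n 3) 4≤t) ⟩
    4 * t          ≤⟨ ℕ.*-monoˡ-≤ t 4≤t ⟩
    t * t          ∎

module _ (n : ℕ) where

  private
    T : ℕ
    T = suc ⌊⁸√ n ⌋

  -- With T ≈ n^{1/8} and P/Q = Σ_{i ≤ 2n} 1/i! → e.
  TooLarge : ℕ → Set
  TooLarge = Exceeds n T (scaledExp (2 * n)) ((2 * n) !)

  tooLarge? : ∀ k → Dec (TooLarge k)
  tooLarge? k = _ ℕ.<? _

  tooLarge⇒rare : ∀ k c Ω .{{_ : NonZero k}} → 4 ≤ ⌊⁸√ n ⌋ → k ≤ n →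
                  c * (2 * k) ! ≤ (2 * n) ^ k * Ω → TooLarge k → c * T ^ 9 ≤ Ω
  tooLarge⇒rare k c Ω 4≤t k≤n moment large = ℕ.*-cancelˡ-≤ (T ^ M) {{ℕ.m^n≢0 T M}} (begin
    T ^ M * (c * T ^ 9)      ≡⟨ rearrange (T ^ M) c (T ^ 9) ⟩
    c * (T ^ M * T ^ 9)      ≤⟨ ℕ.*-monoʳ-≤ c (exponential-growth T 9
                                  (⌊⁸√⌋-square-bound {n} {M} 4≤t (exceeds⇒large n k T P Q (!≤scaledExp (2 * n)) large))) ⟩
    c * suc T ^ M            ≤⟨ exceeds⇒decay n k T P Q c Ω
                                  (factorial-lower M (ℕ.*-monoʳ-≤ 2 k≤n)) moment large ⟩
    T ^ M * Ω                ∎)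
    where
    open ℕ.≤-Reasoning
    M = 2 * k
    P = scaledExp (2 * n)
    Q = (2 * n) !
    instance
      Q≢0 : NonZero Q
      Q≢0 = (2 * n) ℕ.!≢0
    rearrange : ∀ a b c → a * (b * c) ≡ b * (a * c)
    rearrange = solve-∀

-- Comparison with e √(n/2)

frac-mul : ∀ a b c d .{{_ : NonZero b}} .{{_ : NonZero d}} .{{_ : NonZero (b * d)}} →
           (ℤ.+ a) ℚ./ b ℚ.* ((ℤ.+ c) ℚ./ d) ≡ (ℤ.+ (a * c)) ℚ./ (b * d)
frac-mul a b@(suc b-1) c d@(suc d-1) = ℚ.toℚᵘ-injective (begin-equality
  ℚ.toℚᵘ ((ℤ.+ a) ℚ./ b ℚ.* ((ℤ.+ c) ℚ./ d))
    ≃⟨ ℚ.toℚᵘ-homo-* ((ℤ.+ a) ℚ./ b) ((ℤ.+ c) ℚ./ d) ⟩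
  ℚ.toℚᵘ ((ℤ.+ a) ℚ./ b) ℚᵘ.* ℚ.toℚᵘ ((ℤ.+ c) ℚ./ d)
    ≃⟨ ℚᵘ.*-cong (ℚ.toℚᵘ-fromℚᵘ (mkℚᵘ (ℤ.+ a) b-1)) (ℚ.toℚᵘ-fromℚᵘ (mkℚᵘ (ℤ.+ c) d-1)) ⟩
  mkℚᵘ (ℤ.+ a) b-1 ℚᵘ.* mkℚᵘ (ℤ.+ c) d-1
    ≃⟨ ℚᵘ.*≡* (cong (ℤ._* ℤ.+ (b * d)) (sym (ℤ.pos-* a c))) ⟩
  mkℚᵘ (ℤ.+ (a * c)) (ℕ.pred (b * d))
    ≃⟨ ℚ.toℚᵘ-fromℚᵘ (mkℚᵘ (ℤ.+ (a * c)) (ℕ.pred (b * d))) ⟨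
  ℚ.toℚᵘ ((ℤ.+ (a * c)) ℚ./ (b * d)) ∎)
  where open ℚᵘ.≤-Reasoning

frac-nonNeg : ∀ a b .{{_ : NonZero b}} → ℚ.NonNegative ((ℤ.+ a) ℚ./ b)
frac-nonNeg a b = ℚ.normalize-nonNeg a b

expSum≡ : ∀ n → expSum n ≡ ℚ._/_ (ℤ.+ scaledExp n) (n !) {{n ℕ.!≢0}}
expSum≡ zero    = refl
expSum≡ (suc n) = trans
  (cong (ℚ._+ 1/ suc n !) (trans (expSum≡ n)
    (frac-≡ (scaledExp n) (n !) (suc n * scaledExp n) (suc n !) (rearrange (scaledExp n) (suc n) (n !)))))
  (frac-+ (suc n * scaledExp n) 1 (suc n !))
  where
  instance
    n!≢0 : NonZero (n !)
    n!≢0 = n ℕ.!≢0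
    1+n!≢0 : NonZero (suc n !)
    1+n!≢0 = suc n ℕ.!≢0
  rearrange : ∀ a b c → a * (b * c) ≡ b * a * c
  rearrange = solve-∀

-- n/2 is stored in lowest terms, and `√-numerator` reads numerator and denominator as stored.
half-numerator : ∀ n → let q = (ℤ.+ n) ℚ./ 2 in ∣ ↥ q ∣ * 2 ≡ n * ↧ₙ q
half-numerator n = ℚ.normalize-injective-≃ ∣ ↥ q ∣ n (↧ₙ q) 2 (∣q∣/d≡q q)
  where
  q = (ℤ.+ n) ℚ./ 2
  instance
    q≥0 : ℚ.NonNegative q
    q≥0 = frac-nonNeg n 2

√-half-upper : ∀ n N → n * suc N ^ 2 ≤ 2 * suc (√-numerator ((ℤ.+ n) ℚ./ 2) N) ^ 2
√-half-upper n N = ℕ.*-cancelʳ-≤ _ _ d (begin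
  n * suc N ^ 2 * d              ≡⟨ rearrange₁ n (suc N) d ⟩
  n * d * (suc N * suc N)        ≡⟨ cong (_* (suc N * suc N)) (half-numerator n) ⟨
  p * 2 * (suc N * suc N)        ≡⟨ rearrange₂ p (suc N * suc N) ⟩
  2 * (p * (suc N * suc N))      ≤⟨ ℕ.*-monoʳ-≤ 2 (ℕ.<⇒≤ (√-numerator-upper q N)) ⟩
  2 * (a * a * d)                ≡⟨ rearrange₃ a d ⟩
  2 * a ^ 2 * d                  ∎)
  where
  open ℕ.≤-Reasoning
  q = (ℤ.+ n) ℚ./ 2
  p = ∣ ↥ q ∣
  d = ↧ₙ q
  a = suc (√-numerator q N)
  rearrange₁ : ∀ n x d → n * (x * (x * 1)) * d ≡ n * d * (x * x)
  rearrange₁ = solve-∀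
  rearrange₂ : ∀ p x → p * 2 * x ≡ 2 * (p * x)
  rearrange₂ = solve-∀
  rearrange₃ : ∀ a d → 2 * (a * a * d) ≡ 2 * (a * (a * 1)) * d
  rearrange₃ = solve-∀

-- The failed inequality bounds k² by a multiple of n, and √(n/2) is at most its approximation
-- raised by 1/(N + 1): the `suc` pays for rounding down. Roots are compared through squares, after
-- doubling to match 2kQT.
¬exceeds⇒numerator-≤ : ∀ n T P Q k N → ¬ Exceeds n T P Q k →
                k * Q * T * suc N ≤ suc (√-numerator ((ℤ.+ n) ℚ./ 2) N) * suc T * P
¬exceeds⇒numerator-≤ n T P Q k N ¬exceeds = ℕ.*-cancelˡ-≤ 2 (ℕ.≮⇒≥ λ lt → ℕ.<⇒≱ (ℕ.^-monoˡ-< 2 lt) (begin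
  (2 * (k * Q * T * b)) ^ 2             ≡⟨ rearrange₁ k Q T b ⟩
  (2 * k * Q * T) ^ 2 * b ^ 2           ≤⟨ ℕ.*-monoˡ-≤ (b ^ 2) (ℕ.≮⇒≥ ¬exceeds) ⟩
  2 * n * (suc T * P) ^ 2 * b ^ 2       ≡⟨ rearrange₂ n ((suc T * P) ^ 2) (b ^ 2) ⟩
  2 * (suc T * P) ^ 2 * (n * b ^ 2)     ≤⟨ ℕ.*-monoʳ-≤ (2 * (suc T * P) ^ 2) (√-half-upper n N) ⟩
  2 * (suc T * P) ^ 2 * (2 * a ^ 2)     ≡⟨ rearrange₃ (suc T) P a ⟩
  (2 * (a * suc T * P)) ^ 2             ∎))
  where
  open ℕ.≤-Reasoning
  b = suc N
  a = suc (√-numerator ((ℤ.+ n) ℚ./ 2) N)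
  rearrange₁ : ∀ k Q T b → let x = 2 * (k * Q * T * b) ; y = 2 * k * Q * T in
               x * (x * 1) ≡ y * (y * 1) * (b * (b * 1))
  rearrange₁ = solve-∀
  rearrange₂ : ∀ n x y → 2 * n * x * y ≡ 2 * x * (n * y)
  rearrange₂ = solve-∀
  rearrange₃ : ∀ S P a → let x = S * P ; y = 2 * (a * S * P) in
               2 * (x * (x * 1)) * (2 * (a * (a * 1))) ≡ y * (y * 1)
  rearrange₃ = solve-∀

fromℚ-mono : ∀ {p q} → p ℚ.≤ q → fromℚ p ≤ℝ fromℚ q
fromℚ-mono {p} {q} p≤q δ 0<δ = 0 , λ _ _ → ℚ.≤-trans p≤q
  (subst (ℚ._≤ q ℚ.+ δ) (ℚ.+-identityʳ q) (ℚ.+-monoʳ-≤ q (ℚ.<⇒≤ 0<δ)))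

-- The hypothesis unfolds to the conclusion, but checking this for concrete reals
-- would normalise their approximations; for variables it is immediate.
≤ℝ-product : ∀ x y z {q} →
  (∀ δ → 0ℚ ℚ.< δ → ∃ λ N₀ → ∀ N → N₀ ≤ N → q ℚ.≤ approx x N ℚ.* approx y N ℚ.* approx z N ℚ.+ δ) →
  fromℚ q ≤ℝ x *ℝ y *ℝ z
≤ℝ-product x y z h = h

module _ (n T k M : ℕ) .{{_ : NonZero T}} (¬exceeds : ¬ Exceeds n T (scaledExp M) (M !) k) where

  private
    P = scaledExp M
    Q = M !
    S = suc T
    a : ℕ → ℕ
    a = √-numerator ((ℤ.+ n) ℚ./ 2)
    instance
      Q≢0 : NonZero Q
      Q≢0 = M ℕ.!≢0
      TQ≢0 : NonZero (T * Q)
      TQ≢0 = ℕ.m*n≢0 T Q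
      TQb≢0 : ∀ {N} → NonZero (T * Q * suc N)
      TQb≢0 {N} = ℕ.m*n≢0 (T * Q) (suc N)

    1+1/T : (ℤ.+ 1) ℚ./ 1 ℚ.+ (ℤ.+ 1) ℚ./ T ≡ (ℤ.+ S) ℚ./ T
    1+1/T = trans (cong (ℚ._+ (ℤ.+ 1) ℚ./ T) (frac-≡ 1 1 T T (ℕ.*-comm 1 T)))
      (trans (frac-+ T 1 T) (cong (λ c → (ℤ.+ c) ℚ./ T) (ℕ.+-comm T 1)))

    -- The last summand is the price of the `suc`: raising the numerator of the root by 1 costs
    -- SP/(TQ(N + 1)), at most SP/(N + 1), which vanishes as N grows.
    rational-bound : ∀ N → (ℤ.+ k) ℚ./ 1 ℚ.≤
      (ℤ.+ S) ℚ./ T ℚ.* ((ℤ.+ P) ℚ./ Q) ℚ.* ((ℤ.+ a N) ℚ./ suc N) ℚ.+ (ℤ.+ (S * P)) ℚ./ suc N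
    rational-bound N = begin
      (ℤ.+ k) ℚ./ 1
        ≤⟨ frac-≤ k 1 (S * P * a N + S * P) (T * Q * suc N) numerators ⟩
      (ℤ.+ (S * P * a N + S * P)) ℚ./ (T * Q * suc N)
        ≡⟨ frac-+ (S * P * a N) (S * P) (T * Q * suc N) ⟨
      (ℤ.+ (S * P * a N)) ℚ./ (T * Q * suc N) ℚ.+ (ℤ.+ (S * P)) ℚ./ (T * Q * suc N)
        ≤⟨ ℚ.+-mono-≤ (ℚ.≤-reflexive (sym (trans
             (cong (ℚ._* ((ℤ.+ a N) ℚ./ suc N)) (frac-mul S T P Q))
             (frac-mul (S * P) (T * Q) (a N) (suc N)))))
             (frac-≤ (S * P) (T * Q * suc N) (S * P) (suc N)
               (ℕ.*-monoʳ-≤ (S * P) (ℕ.m≤n*m (suc N) (T * Q)))) ⟩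
      (ℤ.+ S) ℚ./ T ℚ.* ((ℤ.+ P) ℚ./ Q) ℚ.* ((ℤ.+ a N) ℚ./ suc N) ℚ.+ (ℤ.+ (S * P)) ℚ./ suc N ∎
      where
      open ℚ.≤-Reasoning
      rearrange₁ : ∀ k T Q b → k * (T * Q * b) ≡ k * Q * T * b
      rearrange₁ = solve-∀
      rearrange₂ : ∀ a S P → suc a * S * P ≡ (S * P * a + S * P) * 1
      rearrange₂ = solve-∀
      numerators : k * (T * Q * suc N) ≤ (S * P * a N + S * P) * 1
      numerators = subst₂ _≤_ (sym (rearrange₁ k T Q (suc N))) (rearrange₂ (a N) S P)
        (¬exceeds⇒numerator-≤ n T P Q k N ¬exceeds)

    x = fromℕ 1 +ℝ fromℚ ((ℤ.+ 1) ℚ./ T)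
    z = √[ n / 2 ]

    approx-x : ∀ N → approx x N ≡ (ℤ.+ S) ℚ./ T
    approx-x N = 1+1/T

    approx-z : ∀ N → approx z N ≡ (ℤ.+ a N) ℚ./ suc N
    approx-z N = refl

    -- From index M on, the approximations of `e` are at least P/Q, the partial sum up to M.
    approx-bound : ∀ {δ N} → M ≤ N → (ℤ.+ (S * P)) ℚ./ suc N ℚ.≤ δ →
      (ℤ.+ k) ℚ./ 1 ℚ.≤ approx x N ℚ.* approx e N ℚ.* approx z N ℚ.+ δ
    approx-bound {δ} {N} M≤N small = begin
      (ℤ.+ k) ℚ./ 1
        ≤⟨ rational-bound N ⟩
      (ℤ.+ S) ℚ./ T ℚ.* ((ℤ.+ P) ℚ./ Q) ℚ.* ((ℤ.+ a N) ℚ./ suc N) ℚ.+ (ℤ.+ (S * P)) ℚ./ suc N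
        ≤⟨ ℚ.+-mono-≤
             (ℚ.*-monoʳ-≤-nonNeg ((ℤ.+ a N) ℚ./ suc N) {{frac-nonNeg (a N) (suc N)}}
               (ℚ.*-monoˡ-≤-nonNeg ((ℤ.+ S) ℚ./ T) {{frac-nonNeg S T}} P/Q≤))
             small ⟩
      (ℤ.+ S) ℚ./ T ℚ.* approx e N ℚ.* ((ℤ.+ a N) ℚ./ suc N) ℚ.+ δ
        ≡⟨ cong₂ (λ u v → u ℚ.* approx e N ℚ.* v ℚ.+ δ) (approx-x N) (approx-z N) ⟨
      approx x N ℚ.* approx e N ℚ.* approx z N ℚ.+ δ ∎
      where
      open ℚ.≤-Reasoning
      P/Q≤ : (ℤ.+ P) ℚ./ Q ℚ.≤ approx e N
      P/Q≤ = subst (ℚ._≤ expSum N) (expSum≡ M) (expSum-mono (ℕ.≤⇒≤′ M≤N))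

  ¬exceeds⇒≤ℝ : fromℕ k ≤ℝ (fromℕ 1 +ℝ fromℚ ((ℤ.+ 1) ℚ./ T)) *ℝ e *ℝ √[ n / 2 ]
  ¬exceeds⇒≤ℝ = ≤ℝ-product x e z λ δ 0<δ → let N₀ , small = archimedean* (S * P) δ 0<δ in
    N₀ ⊔ M , λ N N≥ → approx-bound {δ} {N} (ℕ.m⊔n≤o⇒n≤o N₀ M N≥)
      (ℚ.≤-trans (frac-≤ (S * P) (suc N) (S * P) (suc N₀)
        (ℕ.*-monoʳ-≤ (S * P) (s≤s (ℕ.m⊔n≤o⇒m≤o N₀ M N≥)))) small)

-- The largest contained matching

maximum : {P : Pred ℕ 0ℓ} → Decidable P → ∀ n → (∀ k → P k → k ≤ n) → ∃ P → ∃ (IsMaximum P)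
maximum {P} P? zero bound (k , pk) with z≤n ← bound k pk = 0 , pk , bound
maximum {P} P? (suc n) bound some with P? (suc n)
... | yes p = suc n , p , bound
... | no ¬p = maximum P? n
  (λ k pk → ℕ.≤-pred (ℕ.≤∧≢⇒< (bound k pk) λ { refl → ¬p pk })) some

≼⇒≤ : ∀ {k n} {H : OrderedMatching k} {G : OrderedMatching n} → H ≼ G → k ≤ n
≼⇒≤ {k} {n} (w , incr , _) = ℕ.*-cancelˡ-≤ 2 (Fin.injective⇒≤ (strictlyIncreasing⇒injective w incr))

some-edge : ∀ {n} (G : OrderedMatching n) → .{{NonZero n}} → ∃ λ e → e ∈ edges (graph G)
some-edge {suc n} G with edges (graph G) | proj₁ (proj₂ (isMatching G))
... | e ∷ _ | _ = e , here refl

-- Makes the set of contained sizes nonempty for n > 0, so that it has a maximum. Any edge of `G`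
-- will do, because the edge of `H` can only join its two vertices.
single-≼ : ∀ {n} (H : OrderedMatching 1) (G : OrderedMatching n) → .{{NonZero n}} → H ≼ G
single-≼ {n} H G with some-edge H | some-edge G
... | (i , j) , ij∈ | (u , v) , uv∈ = w , incr , iso
  where
  w : Fin 2 → Fin (2 * n)
  w zero    = u
  w (suc _) = v
  u<v = proj₁ (edges⁻ (graph G) uv∈)
  incr : StrictlyIncreasing w
  incr {zero}     {suc zero} _         = u<v
  incr {suc zero} {suc zero} (s≤s ())
  first : ∀ {i j : Fin 2} → i Fin.< j → Edge (graph H) i j → Edge (graph H) zero (suc zero)
  first {zero}     {suc zero} _ ij     = ij
  first {suc zero} {suc zero} (s≤s ()) _
  iso : OrderIsomorphic (graph H) (restrict (graph G) w)
  iso {zero}     {suc zero} _ = mk⇔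
    (λ _ → edge-restrict⁺ (graph G) w {zero} {suc zero} (proj₂ (edges⁻ (graph G) uv∈)))
    (λ _ → first (proj₁ (edges⁻ (graph H) ij∈)) (proj₂ (edges⁻ (graph H) ij∈)))
  iso {suc zero} {suc zero} (s≤s ())

matchings-nonempty : ∀ n → OrderedMatching n → NonZero (length (matchings n))
matchings-nonempty n G = ℕ.>-nonZero (subst (0 <_) (containCount-[] n)
  (List.filter-some (λ H → isMatching? n H ×-dec contains? [] H)
    (Any.map (λ { refl → isMatching G , [] }) (graphs-complete (graph G)))))

ratio-≡ : ∀ a b .{{_ : NonZero b}} → ratio a b ≡ (ℤ.+ a) ℚ./ b
ratio-≡ a (suc b) = refl

1-1/T≤ratio : ∀ {good bad} Ω T .{{_ : NonZero Ω}} .{{_ : NonZero T}} {δ} →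
              good + bad ≡ Ω → bad * T ≤ Ω → (ℤ.+ 1) ℚ./ T ℚ.≤ δ → 1ℚ ℚ.- δ ℚ.≤ ratio good Ω
1-1/T≤ratio {good} {bad} Ω T {δ} total rare small = +-cancel-≤ {1ℚ} {δ} (begin
  1ℚ                                      ≡⟨ frac-≡ Ω Ω 1 1 (trans (ℕ.*-identityʳ Ω) (sym (ℕ.*-identityˡ Ω))) ⟨
  (ℤ.+ Ω) ℚ./ Ω                             ≡⟨ cong (λ c → (ℤ.+ c) ℚ./ Ω) (trans (ℕ.+-comm bad good) total) ⟨
  (ℤ.+ (bad + good)) ℚ./ Ω                  ≡⟨ frac-+ bad good Ω ⟨
  (ℤ.+ bad) ℚ./ Ω ℚ.+ (ℤ.+ good) ℚ./ Ω        ≤⟨ ℚ.+-monoˡ-≤ ((ℤ.+ good) ℚ./ Ω) (ℚ.≤-trans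
                                               (frac-≤ bad Ω 1 T (subst (bad * T ≤_) (sym (ℕ.*-identityˡ Ω)) rare))
                                               small) ⟩
  δ ℚ.+ (ℤ.+ good) ℚ./ Ω                    ≡⟨ cong (δ ℚ.+_) (ratio-≡ good Ω) ⟨
  δ ℚ.+ ratio good Ω                      ∎)
  where open ℚ.≤-Reasoning

-- The exceptional event and its probability

module _ (M : (k : ℕ) → .{{_ : NonZero k}} → OrderedMatching k) (n : ℕ) where

  private
    T : ℕ
    T = suc ⌊⁸√ n ⌋
    Ω : ℕ
    Ω = length (matchings n)

  -- Index i stands for size i + 1, so that `upTo n` runs over the sizes 1, ..., n. Sizes below the
  -- threshold contribute empty events.
  BadIndex : ℕ → OrderedMatching n → Set
  BadIndex i G = TooLarge n (suc i) × M (suc i) ≼ G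

  badIndex? : ∀ i → Decidable (BadIndex i)
  badIndex? i G = tooLarge? n (suc i) ×-dec embedding? (M (suc i)) n (graph G)

  Bad : OrderedMatching n → Set
  Bad G = Any (λ i → BadIndex i G) (upTo n)

  bad? : Decidable Bad
  bad? G = Any.any? (λ i → badIndex? i G) (upTo n)

  badIndex-rare : 4 ≤ ⌊⁸√ n ⌋ → ∀ {i} → i < n → count (badIndex? i) (matchings n) * T ^ 9 ≤ Ω
  badIndex-rare 4≤t {i} i<n = by-cases (tooLarge? n (suc i))
    where
    open ℕ.≤-Reasoning
    H = M (suc i)
    by-cases : Dec (TooLarge n (suc i)) → count (badIndex? i) (matchings n) * T ^ 9 ≤ Ω
    by-cases (no small) = subst (λ Gs → length Gs * T ^ 9 ≤ Ω)
      (sym (List.filter-none (badIndex? i) (All.universal (λ _ → small ∘ proj₁) (matchings n)))) z≤n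
    by-cases (yes large) = begin
      count (badIndex? i) (matchings n) * T ^ 9
        ≤⟨ ℕ.*-monoˡ-≤ (T ^ 9) (count-mono (badIndex? i) (embedding? H n ∘ graph) (λ _ → proj₂) (matchings n)) ⟩
      count (embedding? H n ∘ graph) (matchings n) * T ^ 9
        ≡⟨ cong (_* T ^ 9) (count-matchings n (embedding? H n)) ⟩
      matchingCount n (embedding? H n) * T ^ 9
        ≤⟨ tooLarge⇒rare n (suc i) (matchingCount n (embedding? H n)) Ω 4≤t i<n (embeddingCount-bound n H i<n) large ⟩
      Ω ∎

  bad-rare : 4 ≤ ⌊⁸√ n ⌋ → count bad? (matchings n) * T ≤ Ω
  bad-rare 4≤t = ℕ.*-cancelˡ-≤ (T ^ 8) {{ℕ.m^n≢0 T 8}} (begin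
    T ^ 8 * (count bad? (matchings n) * T)   ≡⟨ rearrange (T ^ 8) (count bad? (matchings n)) T ⟩
    count bad? (matchings n) * T ^ 9
      ≤⟨ union-bound badIndex? bad? (matchings n) (upTo n) (T ^ 9) Ω (λ _ → id)
           (All.tabulate λ i∈ → badIndex-rare 4≤t (∈.∈-upTo⁻ i∈)) ⟩
    length (upTo n) * Ω                      ≡⟨ cong (_* Ω) (List.length-upTo n) ⟩
    n * Ω                                    ≤⟨ ℕ.*-monoˡ-≤ Ω (ℕ.<⇒≤ (⌊⁸√⌋-upper n)) ⟩
    T ^ 8 * Ω                                ∎)
    where
    open ℕ.≤-Reasoning
    rearrange : ∀ x c t → x * (c * t) ≡ c * (t * x)
    rearrange = solve-∀

  Contained : OrderedMatching n → ℕ → Set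
  Contained G k = Σ[ k≢0 ∈ NonZero k ] M k {{k≢0}} ≼ G

  contained? : ∀ G → Decidable (Contained G)
  contained? G zero    = no λ ()
  contained? G (suc k) = map′ (_ ,_) proj₂ (embedding? (M (suc k)) n (graph G))

  good⇒maximum-small : .{{NonZero n}} → ∀ G → ¬ Bad G →
    ∃ λ m → IsMaximum (Contained G) m ×
            -- The maximum is itself a contained size, so if it were too large it would be a bad
            -- index.
            fromℕ m ≤ℝ (fromℕ 1 +ℝ fromℚ ((ℤ.+ 1) ℚ./ T)) *ℝ e *ℝ √[ n / 2 ]
  good⇒maximum-small G ¬bad = bounded-maximum
    (maximum (contained? G) n (λ k (k≢0 , emb) → ≼⇒≤ {H = M k {{k≢0}}} {G} emb)
      (1 , _ , single-≼ (M 1) G))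
    where
    bounded-maximum : ∃ (IsMaximum (Contained G)) →
      ∃ λ m → IsMaximum (Contained G) m ×
              fromℕ m ≤ℝ (fromℕ 1 +ℝ fromℚ ((ℤ.+ 1) ℚ./ T)) *ℝ e *ℝ √[ n / 2 ]
    bounded-maximum (zero  , ((() , _) , _))
    bounded-maximum (suc m , max@((_ , emb) , _)) = suc m , max ,
      ¬exceeds⇒≤ℝ n T (suc m) (2 * n) λ large →
        ¬bad (lose (∈.∈-upTo⁺ (≼⇒≤ {H = M (suc m)} {G} emb)) (large , emb))

proposition11 : (M : (k : ℕ) → .{{_ : NonZero k}} → OrderedMatching k) →
    Σ[ ε ∈ (ℕ → ℝ) ] (ε ⟶0) ×
    AsymptoticallyAlmostSurely (λ n RM →
    ∃ λ m → IsMaximum (λ k → Σ[ k≢0 ∈ NonZero k ] M k {{k≢0}} ≼ RM) m ×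
    fromℕ m ≤ℝ (fromℕ 1 +ℝ ε n) *ℝ e *ℝ √[ n / 2 ])
proposition11 M = (λ n → fromℚ (1/T n)) , vanishing , λ δ 0<δ →
  let N , small = eventually-small δ 0<δ
      N′ , 4≤ = ⌊⁸√⌋-unbounded 4
  in N ⊔ N′ , λ n N≤n → likely n
       (4≤ n (ℕ.m⊔n≤o⇒n≤o N N′ N≤n)) (small n (ℕ.m⊔n≤o⇒m≤o N N′ N≤n))
  where
  1/T : ℕ → ℚ
  1/T n = (ℤ.+ 1) ℚ./ suc ⌊⁸√ n ⌋
  eventually-small : ∀ δ → 0ℚ ℚ.< δ → ∃ λ N → ∀ n → N ≤ n → 1/T n ℚ.≤ δ
  eventually-small δ 0<δ =
    let c , 1/c≤δ = archimedean δ 0<δ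
        N , c≤    = ⌊⁸√⌋-unbounded c in
    N , λ n N≤n → ℚ.≤-trans (1/-anti (c≤ n N≤n)) 1/c≤δ
  vanishing : (λ n → fromℚ (1/T n)) ⟶0
  vanishing δ 0<δ with N , small ← eventually-small δ 0<δ = N , λ n N≤n →
    fromℚ-mono (ℚ.≤-trans (ℚ.neg-antimono-≤ (ℚ.<⇒≤ 0<δ)) (frac-≤ 0 1 1 (suc ⌊⁸√ n ⌋) z≤n)) ,
    fromℚ-mono (small n N≤n)
  likely : ∀ n → 4 ≤ ⌊⁸√ n ⌋ → ∀ {δ} → 1/T n ℚ.≤ δ →
           PrAtLeast (1ℚ ℚ.- δ) (matchings n) (λ G → ∃ λ m → IsMaximum (Contained M n G) m ×
             fromℕ m ≤ℝ (fromℕ 1 +ℝ fromℚ (1/T n)) *ℝ e *ℝ √[ n / 2 ])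
  -- The case n = 0 is void because `⌊⁸√ 0 ⌋` is 0.
  likely n@(suc _) 4≤t small =
    good ,
    (λ G _ isGood → good⇒maximum-small M n G (toWitness isGood)) ,
    -- The given matching `M n` witnesses that the sample space is nonempty.
    1-1/T≤ratio (length (matchings n)) (suc ⌊⁸√ n ⌋) {{matchings-nonempty n (M n)}}
      (count-complement (T? ∘ good) (matchings n))
      (ℕ.≤-trans (ℕ.*-monoˡ-≤ (suc ⌊⁸√ n ⌋) (count-mono (¬? ∘ T? ∘ good) (bad? M n)
          (λ G ¬good → decidable-stable (bad? M n G) (¬good ∘ fromWitness)) (matchings n)))
        (bad-rare M n 4≤t))
      small
    where
    good : OrderedMatching n → Bool
    good G = ⌊ ¬? (bad? M n G) ⌋
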